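{- $6-4\sqrt{2}\leq i(\vec K_{1,2})=i(\vec K_{2,1})\leq 0.4644$.
   Context: An orgraph (oriented graph) is a directed graph with no loops, no multiple edges, and no pair of vertices joined by edges in both directions. For a finite orgraph $\Gamma$ and an integer $n$, let $max(\Gamma;n)$ be the maximum, over all orgraphs $G$ on $n$ vertices, of the number of vertex subsets $T\subseteq V(G)$ with $|T|=|V(\Gamma)|$ such that the subgraph of $G$ induced by $T$ is isomorphic to $\Gamma$ (each such set is counted once, regardless of automorphisms of $\Gamma$). The inducibility of $\Gamma$ is $i(\Gamma):=\limsup_{n\to\infty} max(\Gamma;n)/\binom{n}{|V(\Gamma)|}$. Here $\vec K_{1,2}$ is the orgraph on vertices $a,b,c$ with edges $a\to b$ and $a\to c$ only (one vertex sending edges to two non-adjacent vertices), and $\vec K_{2,1}$ is the orgraph on vertices $a,b,c$ with edges $b\to a$ and $c\to a$ only (two non-adjacent vertices both sending an edge to a third vertex). -}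

module Defs where

open import Data.Bool using (Bool; true; false)
import Data.Bool.Properties as Bool
open import Data.Empty using (⊥)
open import Data.Fin using (Fin)
import Data.Fin.Properties as Fin
open import Data.Fin.Subset using (Subset; inside; outside; _∈_; ∣_∣)
open import Data.Fin.Subset.Properties using (_∈?_)
open import Data.Integer using (+_)
open import Data.List using (List; []; _∷_; length; map; filter; cartesianProductWith; allFin)
open import Data.List.Extrema.Nat using (max; argmax-sel; xs≤max)
import Data.List.Membership.Propositional as List
open import Data.List.Membership.Propositional.Properties using (∈-map⁺; ∈-map⁻; ∈-filter⁺; ∈-filter⁻; ∈-cartesianProductWith⁺; ∈-allFin)
open import Data.List.Relation.Unary.All as All using ()
open import Data.List.Relation.Unary.Any as Any using (here; there)
open import Data.Nat as ℕ using (ℕ; zero; suc)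
import Data.Nat.Properties as ℕ
open import Data.Nat.Combinatorics using (_C_)
open import Data.Product using (_×_; _,_; ∃; ∃-syntax; Σ-syntax)
open import Data.Rational using (ℚ; 0ℚ; 1ℚ; _/_; _+_; _-_; -_; _*_; 1/_; _≤_; _<_; Positive; NonZero; positive)
import Data.Rational.Properties as ℚ
open import Data.Rational.Solver using (module +-*-Solver)
open import Data.Sum as Sum using (_⊎_; inj₁; inj₂)
open import Data.Vec using (Vec; []; _∷_; lookup; replicate)
open import Data.Vec.Properties using (lookup-replicate)
open import Relation.Binary.PropositionalEquality using (_≡_; refl; sym; trans; cong; subst)
open import Relation.Nullary using (yes; no; contradiction)
open import Relation.Nullary.Decidable using (_×-dec_; _→-dec_; from-yes; map′)
open import Relation.Unary using (Decidable)

------------------------------------------------------------------------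
-- Orgraphs

-- Adjacency matrices: lookup (lookup D i) j ≡ true means i → j.
Digraph : ℕ → Set
Digraph n = Vec (Vec Bool n) n

edge : ∀ {n} → Digraph n → Fin n → Fin n → Bool
edge D i j = lookup (lookup D i) j

IsOrgraph : ∀ {n} → Digraph n → Set
IsOrgraph D =
    (∀ i → edge D i i ≡ false)
  × (∀ i j → edge D i j ≡ true → edge D j i ≡ false)

isOrgraph? : ∀ {n} → Decidable (IsOrgraph {n})
isOrgraph? D =
        Fin.all? (λ i → edge D i i Bool.≟ false)
  ×-dec Fin.all? (λ i → Fin.all? (λ j →
          (edge D i j Bool.≟ true) →-dec (edge D j i Bool.≟ false)))

record Orgraph (n : ℕ) : Set where
  constructor orgraph
  field
    digraph   : Digraph n
    isOrgraph : IsOrgraph digraph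

open Orgraph public

-- Vertex 0 is the vertex a, vertices 1 and 2 are b and c.
K₁,₂ : Orgraph 3
K₁,₂ = orgraph D (from-yes (isOrgraph? D))
  where
  D : Digraph 3
  D = (false ∷ true  ∷ true  ∷ [])
    ∷ (false ∷ false ∷ false ∷ [])
    ∷ (false ∷ false ∷ false ∷ [])
    ∷ []

K₂,₁ : Orgraph 3
K₂,₁ = orgraph D (from-yes (isOrgraph? D))
  where
  D : Digraph 3
  D = (false ∷ false ∷ false ∷ [])
    ∷ (true  ∷ false ∷ false ∷ [])
    ∷ (true  ∷ false ∷ false ∷ [])
    ∷ []

------------------------------------------------------------------------
-- Induced copies

-- An isomorphism from Γ onto the subgraph of G induced by T, given as the
-- vector f of images of the vertices of Γ.
IsIsoOnto : ∀ {k n} → Digraph k → Digraph n → Subset n → Vec (Fin n) k → Set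
IsIsoOnto Γ G T f =
    (∀ i j → lookup f i ≡ lookup f j → i ≡ j)
  × (∀ i → lookup f i ∈ T)
  × (∀ x → x ∈ T → ∃[ i ] lookup f i ≡ x)
  × (∀ i j → edge G (lookup f i) (lookup f j) ≡ edge Γ i j)

InducesCopy : ∀ {k n} → Digraph k → Digraph n → Subset n → Set
InducesCopy {k} Γ G T = ∣ T ∣ ≡ k × ∃[ f ] IsIsoOnto Γ G T f

vecs : ∀ {A : Set} → List A → (n : ℕ) → List (Vec A n)
vecs xs zero    = [] ∷ []
vecs xs (suc n) = cartesianProductWith _∷_ xs (vecs xs n)

vecs-complete : ∀ {A : Set} {xs : List A} → (∀ x → x List.∈ xs) →
                ∀ {n} (v : Vec A n) → v List.∈ vecs xs n
vecs-complete all []      = here refl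
vecs-complete all (x ∷ v) = ∈-cartesianProductWith⁺ _∷_ (all x) (vecs-complete all v)

isIsoOnto? : ∀ {k n} (Γ : Digraph k) (G : Digraph n) (T : Subset n) →
             Decidable (IsIsoOnto Γ G T)
isIsoOnto? Γ G T f =
        Fin.all? (λ i → Fin.all? (λ j → (lookup f i Fin.≟ lookup f j) →-dec (i Fin.≟ j)))
  ×-dec Fin.all? (λ i → lookup f i ∈? T)
  ×-dec Fin.all? (λ x → (x ∈? T) →-dec Fin.any? (λ i → lookup f i Fin.≟ x))
  ×-dec Fin.all? (λ i → Fin.all? (λ j →
          edge G (lookup f i) (lookup f j) Bool.≟ edge Γ i j))

inducesCopy? : ∀ {k n} (Γ : Digraph k) (G : Digraph n) → Decidable (InducesCopy Γ G)
inducesCopy? {k} {n} Γ G T = (∣ T ∣ ℕ.≟ k) ×-dec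
  map′ Any.satisfied
       (λ { (f , iso) → List.lose (vecs-complete ∈-allFin f) iso })
       (Any.any? (isIsoOnto? Γ G T) (vecs (allFin n) k))

bools : List Bool
bools = outside ∷ inside ∷ []

bools-complete : ∀ b → b List.∈ bools
bools-complete false = here refl
bools-complete true  = there (here refl)

subsets : (n : ℕ) → List (Subset n)
subsets = vecs bools

#induced : ∀ {k n} → Digraph k → Digraph n → ℕ
#induced {n = n} Γ G = length (filter (inducesCopy? Γ G) (subsets n))

orgraphs : (n : ℕ) → List (Digraph n)
orgraphs n = filter isOrgraph? (vecs (vecs bools n) n)

orgraphs-complete : ∀ {n} (G : Orgraph n) → digraph G List.∈ orgraphs n
orgraphs-complete (orgraph D isO) =
  ∈-filter⁺ isOrgraph? (vecs-complete (vecs-complete bools-complete) D) isO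

maxInduced : ∀ {k} → Orgraph k → ℕ → ℕ
maxInduced Γ n = max 0 (map (#induced (digraph Γ)) (orgraphs n))

-- The base value 0 passed to max is harmless: maxInduced is a maximum over Orgraph n.

maxInduced-upper : ∀ {k n} (Γ : Orgraph k) (G : Orgraph n) →
                   #induced (digraph Γ) (digraph G) ℕ.≤ maxInduced Γ n
maxInduced-upper {n = n} Γ G =
  All.lookup (xs≤max 0 (map (#induced (digraph Γ)) (orgraphs n)))
             (∈-map⁺ (#induced (digraph Γ)) (orgraphs-complete G))

edgeless : ∀ n → Orgraph n
edgeless n = orgraph E ((λ i → E-false i i) , λ i j _ → E-false j i)
  where
  E : Digraph n
  E = replicate n (replicate n false)
  E-false : ∀ i j → edge E i j ≡ false
  E-false i j = trans (cong (λ row → lookup row j) (lookup-replicate i (replicate n false)))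
                      (lookup-replicate j false)

maxInduced-attained : ∀ {k} (Γ : Orgraph k) n →
                      Σ[ G ∈ Orgraph n ] #induced (digraph Γ) (digraph G) ≡ maxInduced Γ n
maxInduced-attained Γ n
  with argmax-sel (λ m → m) 0 (map (#induced (digraph Γ)) (orgraphs n))
... | inj₁ max≡0 = edgeless n ,
  ℕ.≤-antisym (maxInduced-upper Γ (edgeless n)) (ℕ.≤-trans (ℕ.≤-reflexive max≡0) ℕ.z≤n)
... | inj₂ max∈ with ∈-map⁻ (#induced (digraph Γ)) max∈
... | D , D∈ , eq with ∈-filter⁻ isOrgraph? {xs = vecs (vecs bools n) n} D∈
... | _ , isO = orgraph D isO , sym eq

-- m / d, with the junk value 0 for d = 0.
ratio : ℕ → ℕ → ℚ
ratio m zero    = 0ℚ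
ratio m (suc d) = + m / suc d

-- Junk value 0 for n < k, where the binomial coefficient vanishes; this does
-- not affect the limit superior.
density : ∀ {k} → Orgraph k → ℕ → ℚ
density {k} Γ n = ratio (maxInduced Γ n) (n C k)

------------------------------------------------------------------------
-- Dedekind reals

-- lower q means q < x and upper q means x < q.
record ℝ : Set₁ where
  field
    lower upper     : ℚ → Set
    lower-inhabited : ∃ lower
    upper-inhabited : ∃ upper
    lower-closed    : ∀ {p q} → p < q → lower q → lower p
    upper-closed    : ∀ {p q} → p < q → upper p → upper q
    lower-open      : ∀ {p} → lower p → ∃[ q ] p < q × lower q
    upper-open      : ∀ {q} → upper q → ∃[ p ] p < q × upper p
    disjoint        : ∀ {q} → lower q → upper q → ⊥
    located         : ∀ {p q} → p < q → lower p ⊎ upper q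

open ℝ public

infix 4 _≤ᴿ_ _≃ᴿ_

_≤ᴿ_ : ℝ → ℝ → Set
x ≤ᴿ y = ∀ q → lower x q → lower y q

_≃ᴿ_ : ℝ → ℝ → Set
x ≃ᴿ y = x ≤ᴿ y × y ≤ᴿ x

private
  p-1<p : ∀ p → p - 1ℚ < p
  p-1<p p = subst (p - 1ℚ <_) (ℚ.+-identityʳ p)
                  (ℚ.+-monoʳ-< p (from-yes ((- 1ℚ) ℚ.<? 0ℚ)))

  p<p+1 : ∀ p → p < p + 1ℚ
  p<p+1 p = subst (_< p + 1ℚ) (ℚ.+-identityʳ p)
                  (ℚ.+-monoʳ-< p (from-yes (0ℚ ℚ.<? 1ℚ)))

  c-[c-p]≡p : ∀ c p → c - (c - p) ≡ p
  c-[c-p]≡p = solve 2 (λ c p → c :- (c :- p) := p) refl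
    where open +-*-Solver

  c-anti : ∀ c {p q} → p < q → c - q < c - p
  c-anti c p<q = ℚ.+-monoʳ-< c (ℚ.neg-antimono-< p<q)

  p<c-r : ∀ c {p r} → r < c - p → p < c - r
  p<c-r c {p} {r} r<c-p = subst (_< c - r) (c-[c-p]≡p c p) (c-anti c r<c-p)

  c-r<p : ∀ c {p r} → c - p < r → c - r < p
  c-r<p c {p} {r} c-p<r = subst (c - r <_) (c-[c-p]≡p c p) (c-anti c c-p<r)

fromℚ : ℚ → ℝ
fromℚ r = record
  { lower           = _< r
  ; upper           = r <_
  ; lower-inhabited = r - 1ℚ , p-1<p r
  ; upper-inhabited = r + 1ℚ , p<p+1 r
  ; lower-closed    = ℚ.<-trans
  ; upper-closed    = λ p<q r<p → ℚ.<-trans r<p p<q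
  ; lower-open      = λ p<r → let m , p<m , m<r = ℚ.<-dense p<r in m , p<m , m<r
  ; upper-open      = λ r<q → let m , r<m , m<q = ℚ.<-dense r<q in m , m<q , r<m
  ; disjoint        = ℚ.<-asym
  ; located         = loc
  }
  where
  loc : ∀ {p q} → p < q → p < r ⊎ r < q
  loc {p} {q} p<q with p ℚ.<? r
  ... | yes p<r = inj₁ p<r
  ... | no  p≮r = inj₂ (ℚ.≤-<-trans (ℚ.≮⇒≥ p≮r) p<q)

infixl 6 _-ᴿ_
infixl 7 _*ᴿ_

-- c - x for rational c:  q < c - x  iff  x < c - q.
_-ᴿ_ : ℚ → ℝ → ℝ
c -ᴿ x = record
  { lower           = λ q → upper x (c - q)
  ; upper           = λ q → lower x (c - q)
  ; lower-inhabited = let q , u = upper-inhabited x in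
                      c - q , subst (upper x) (sym (c-[c-p]≡p c q)) u
  ; upper-inhabited = let q , l = lower-inhabited x in
                      c - q , subst (lower x) (sym (c-[c-p]≡p c q)) l
  ; lower-closed    = λ p<q → upper-closed x (c-anti c p<q)
  ; upper-closed    = λ p<q → lower-closed x (c-anti c p<q)
  ; lower-open      = λ u → let r , r< , ur = upper-open x u in
                      c - r , p<c-r c r< , subst (upper x) (sym (c-[c-p]≡p c r)) ur
  ; upper-open      = λ l → let r , <r , lr = lower-open x l in
                      c - r , c-r<p c <r , subst (lower x) (sym (c-[c-p]≡p c r)) lr
  ; disjoint        = λ u l → disjoint x l u
  ; located         = λ p<q → Sum.swap (located x (c-anti c p<q))
  }

-- c * x for positive rational c:  q < c * x  iff  q ÷ c < x.
_*ᴿ_ : (c : ℚ) .{{_ : Positive c}} → ℝ → ℝ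
c *ᴿ x = record
  { lower           = λ q → lower x (q * c⁻¹)
  ; upper           = λ q → upper x (q * c⁻¹)
  ; lower-inhabited = let q , l = lower-inhabited x in q * c , subst (lower x) (sym (cancel q)) l
  ; upper-inhabited = let q , u = upper-inhabited x in q * c , subst (upper x) (sym (cancel q)) u
  ; lower-closed    = λ p<q → lower-closed x (mono p<q)
  ; upper-closed    = λ p<q → upper-closed x (mono p<q)
  ; lower-open      = λ {p} l → let r , <r , lr = lower-open x l in
                      r * c , subst (_< r * c) (cancel′ p) (ℚ.*-monoˡ-<-pos c <r)
                            , subst (lower x) (sym (cancel r)) lr
  ; upper-open      = λ {q} u → let r , r< , ur = upper-open x u in
                      r * c , subst (r * c <_) (cancel′ q) (ℚ.*-monoˡ-<-pos c r<)
                            , subst (upper x) (sym (cancel r)) ur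
  ; disjoint        = disjoint x
  ; located         = λ p<q → located x (mono p<q)
  }
  where
  instance
    c≢0 : NonZero c
    c≢0 = ℚ.pos⇒nonZero c
  c⁻¹ : ℚ
  c⁻¹ = 1/ c
  mono : ∀ {p q} → p < q → p * c⁻¹ < q * c⁻¹
  mono = ℚ.*-monoˡ-<-pos c⁻¹ {{ℚ.1/pos⇒pos c}}
  cancel : ∀ q → q * c * c⁻¹ ≡ q
  cancel q = trans (ℚ.*-assoc q c c⁻¹)
            (trans (cong (q *_) (ℚ.*-inverseʳ c)) (ℚ.*-identityʳ q))
  cancel′ : ∀ q → q * c⁻¹ * c ≡ q
  cancel′ q = trans (ℚ.*-assoc q c⁻¹ c)
             (trans (cong (q *_) (ℚ.*-inverseˡ c)) (ℚ.*-identityʳ q))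

-- The supremum of the rationals r with r² ≤ 2, which is also the infimum of
-- the positive rationals r with 2 < r².
√2 : ℝ
√2 = record
  { lower           = λ q → ∃[ r ] q < r × r * r ≤ 2ℚ
  ; upper           = λ q → ∃[ r ] r < q × 0ℚ < r × 2ℚ < r * r
  ; lower-inhabited = 0ℚ , 1ℚ , from-yes (0ℚ ℚ.<? 1ℚ) , from-yes (1ℚ * 1ℚ ℚ.≤? 2ℚ)
  ; upper-inhabited = + 3 / 1 , 2ℚ , from-yes (2ℚ ℚ.<? + 3 / 1)
                    , from-yes (0ℚ ℚ.<? 2ℚ) , from-yes (2ℚ ℚ.<? 2ℚ * 2ℚ)
  ; lower-closed    = λ p<q (r , q<r , r²≤2) → r , ℚ.<-trans p<q q<r , r²≤2
  ; upper-closed    = λ p<q (r , r<p , rest) → r , ℚ.<-trans r<p p<q , rest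
  ; lower-open      = λ (r , p<r , r²≤2) → let m , p<m , m<r = ℚ.<-dense p<r in
                      m , p<m , r , m<r , r²≤2
  ; upper-open      = λ (r , r<q , rest) → let m , r<m , m<q = ℚ.<-dense r<q in
                      m , m<q , r , r<m , rest
  ; disjoint        = λ (r , q<r , r²≤2) (s , s<q , 0<s , 2<s²) →
                      ℚ.<-irrefl refl (ℚ.<-≤-trans
                        (ℚ.<-trans 2<s² (square-mono 0<s (ℚ.<-trans s<q q<r))) r²≤2)
  ; located         = loc
  }
  where
  2ℚ : ℚ
  2ℚ = + 2 / 1
  square-mono : ∀ {s r} → 0ℚ < s → s < r → s * s < r * r
  square-mono {s} {r} 0<s s<r = ℚ.<-trans
    (ℚ.*-monoʳ-<-pos s {{positive 0<s}} s<r)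
    (ℚ.*-monoˡ-<-pos r {{positive (ℚ.<-trans 0<s s<r)}} s<r)
  loc : ∀ {p q} → p < q →
        (∃[ r ] p < r × r * r ≤ 2ℚ) ⊎ (∃[ r ] r < q × 0ℚ < r × 2ℚ < r * r)
  loc p<q with ℚ.<-dense p<q
  ... | s , p<s , s<q with 0ℚ ℚ.<? s | s * s ℚ.≤? 2ℚ
  ... | no  s≤0 | _        = inj₁ (0ℚ , ℚ.<-≤-trans p<s (ℚ.≮⇒≥ s≤0) , from-yes (0ℚ * 0ℚ ℚ.≤? 2ℚ))
  ... | yes 0<s | yes s²≤2 = inj₁ (s , p<s , s²≤2)
  ... | yes 0<s | no  s²≰2 = inj₂ (s , s<q , 0<s , ℚ.≰⇒> s²≰2)

------------------------------------------------------------------------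
-- Inducibility

-- x = limsup aₙ: for every rational q > x eventually aₙ < q, and for every
-- rational q < x infinitely often q < aₙ.
IsLimsup : (ℕ → ℚ) → ℝ → Set
IsLimsup a x =
    (∀ q → upper x q → ∃[ N ] ∀ n → N ℕ.≤ n → a n < q)
  × (∀ q → lower x q → ∀ N → ∃[ n ] N ℕ.≤ n × q < a n)

IsLimsup-unique : ∀ {a x y} → IsLimsup a x → IsLimsup a y → x ≃ᴿ y
IsLimsup-unique {a} {x} {y} X Y = half {x} {y} X Y , half {y} {x} Y X
  where
  half : ∀ {x y} → IsLimsup a x → IsLimsup a y → x ≤ᴿ y
  half {x} {y} (_ , often) (eventually , _) q q<x with lower-open x q<x
  ... | r , q<r , r<x with located y q<r
  ...   | inj₁ q<y = q<y
  ...   | inj₂ y<r with eventually r y<r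
  ...     | N , below with often r r<x N
  ...       | n , N≤n , r<an = contradiction (below n N≤n) (ℚ.<-asym r<an)

IsInducibility : ∀ {k} → Orgraph k → ℝ → Set
IsInducibility Γ = IsLimsup (density Γ)

{-# OPTIONS --safe #-}
module Submission where

-- Write star(G) for the number of triples (a, b, c) with a → b, a → c and b, c
-- non-adjacent, b = c being allowed, and M(n) for the maximal number of induced
-- stars on n vertices.  Averaging the number of induced stars in the pullback
-- of G along a map from N vertices into G gives star(G) / n³ ≤ M(N) / 3 C(N,3),
-- hence 6 M(n) / n³ ≤ M(N) / C(N,3) for all n and N.  As the two sides differ by
-- O(1/n) for n = N, the densities converge, with an explicit rate, and both
-- sides bound the limit.  The lower bound is then read off a graph on seven
-- vertices.  For the upper bound, weight the vertices: moving all the weight of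
-- one of two non-adjacent vertices to the other, in one of the two directions,
-- does not decrease the star count, so the support may be assumed to be a
-- tournament, and removing its heaviest vertex, of weight x out of x + s, loses
-- at most x² s.  Induction bounds the star count by c (x + s)³ / 3 as soon as
-- c ≥ 2√3 - 3.  Reversing all edges exchanges the two stars.

open import Defs
open import Data.Bool using (Bool; true; false; not; _∧_)
open import Data.Bool.Properties using (∧-comm)
open import Data.Fin as Fin using (Fin; zero; suc; toℕ)
import Data.Fin.Properties as Fin
open import Data.Fin.Subset as Subset using (Subset; ⁅_⁆; _∪_; ∣_∣)
open import Data.Fin.Subset.Properties using (x∈⁅x⁆; x∈⁅y⁆⇒x≡y; ∣⁅x⁆∣≡1; ⊆-antisym; ∪-comm; ∪-assoc; ∪-identityʳ; x∈p∪q⁻; x∈p∪q⁺)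
import Data.Integer as ℤ
import Data.Integer.Properties as ℤ
import Data.Integer.Tactic.RingSolver as ℤ
open import Data.List using (List; []; _∷_; _++_; length; map; filter; allFin; cartesianProduct; cartesianProductWith)
open import Data.List.Membership.Propositional using (_∈_)
open import Data.List.Membership.Propositional.Properties using (∈-∃++; ∈-++⁻; ∈-++⁺ˡ; ∈-++⁺ʳ; ∈-filter⁺; ∈-filter⁻; ∈-cartesianProduct⁺; ∈-allFin)
open import Data.List.Properties using (length-tabulate; map-tabulate; length-++-sucʳ)
open import Data.List.Relation.Binary.Permutation.Propositional as Perm using (_↭_; ↭-refl; ↭-prep; ↭-swap; ↭-trans)
open import Data.List.Relation.Binary.Permutation.Propositional.Properties using (↭-length)
open import Data.List.Relation.Unary.All as All using (All; []; _∷_)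
open import Data.List.Relation.Unary.AllPairs using (AllPairs; []; _∷_)
open import Data.List.Relation.Unary.Any using (here; there)
open import Data.List.Relation.Unary.Unique.Propositional using (Unique)
import Data.List.Relation.Unary.Unique.Propositional.Properties as Unique
open import Data.Nat hiding (_/_)
open import Data.Nat.Combinatorics using (_C_; nC1≡n; nCk+nC[k+1]≡[n+1]C[k+1])
open import Data.Nat.Coprimality using (Coprime)
open import Data.Nat.Properties
open import Data.Nat.Tactic.RingSolver using (solve-∀)
open import Data.Product using (_×_; _,_; ∃-syntax; Σ-syntax; proj₁; proj₂)
open import Data.Rational as ℚ using (ℚ; mkℚ; 0ℚ; 1ℚ; _/_)
import Data.Rational.Properties as ℚ
open import Data.Rational.Solver using (module +-*-Solver)
open import Data.Rational.Unnormalised using (mkℚᵘ; *≤*; *<*; *≡*)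
import Data.Rational.Unnormalised.Properties as ℚᵘ
open import Data.Sum using (_⊎_; inj₁; inj₂; [_,_]′)
open import Data.Vec as Vec using (Vec; []; _∷_; lookup; _[_]≔_)
open import Data.Vec.Properties using (lookup∘update; lookup∘update′; lookup∘tabulate; ∷-injective)
open import Function using (_∘_; id; _⟨_⟩_)
open import Relation.Binary using (Tri; tri<; tri≈; tri>)
open import Relation.Binary.PropositionalEquality
open import Relation.Nullary using (Dec; does; yes; no; contradiction)
open import Relation.Nullary.Decidable using (_×-dec_; dec-true; dec-false; from-yes)
open import Relation.Unary using (Decidable)

private variable
  A B : Set
  n : ℕ

-- Finite sums

∑ : List A → (A → ℕ) → ℕ
∑ []       f = 0
∑ (x ∷ xs) f = f x + ∑ xs f

∑-cong : ∀ (xs : List A) {f g} → (∀ x → f x ≡ g x) → ∑ xs f ≡ ∑ xs g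
∑-cong []       f≗g = refl
∑-cong (x ∷ xs) f≗g = cong₂ _+_ (f≗g x) (∑-cong xs f≗g)

∑-mono : ∀ (xs : List A) {f g} → (∀ x → f x ≤ g x) → ∑ xs f ≤ ∑ xs g
∑-mono []       f≤g = z≤n
∑-mono (x ∷ xs) f≤g = +-mono-≤ (f≤g x) (∑-mono xs f≤g)

∑-cong-All : ∀ {xs : List A} {f g} → All (λ x → f x ≡ g x) xs → ∑ xs f ≡ ∑ xs g
∑-cong-All []         = refl
∑-cong-All (eq ∷ eqs) = cong₂ _+_ eq (∑-cong-All eqs)

∑-+ : ∀ (xs : List A) f g → ∑ xs (λ x → f x + g x) ≡ ∑ xs f + ∑ xs g
∑-+ []       f g = refl
∑-+ (x ∷ xs) f g = trans (cong (f x + g x +_) (∑-+ xs f g)) (lemma (f x) (g x) _ _)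
  where
  lemma : ∀ a b c d → a + b + (c + d) ≡ a + c + (b + d)
  lemma = solve-∀

∑-* : ∀ (xs : List A) k f → ∑ xs (λ x → k * f x) ≡ k * ∑ xs f
∑-* []       k f = sym (*-zeroʳ k)
∑-* (x ∷ xs) k f = trans (cong (k * f x +_) (∑-* xs k f)) (sym (*-distribˡ-+ k (f x) _))

∑-const : ∀ (xs : List A) k → ∑ xs (λ _ → k) ≡ length xs * k
∑-const []       k = refl
∑-const (x ∷ xs) k = cong (k +_) (∑-const xs k)

∑-zero : ∀ (xs : List A) → ∑ xs (λ _ → 0) ≡ 0
∑-zero xs = trans (∑-const xs 0) (*-zeroʳ (length xs))

∑-comm : ∀ (xs : List A) (ys : List B) (f : A → B → ℕ) →
         ∑ xs (λ x → ∑ ys (f x)) ≡ ∑ ys (λ y → ∑ xs (λ x → f x y))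
∑-comm []       ys f = sym (∑-zero ys)
∑-comm (x ∷ xs) ys f =
  trans (cong (∑ ys (f x) +_) (∑-comm xs ys f)) (sym (∑-+ ys (f x) _))

∑-++ : ∀ (xs ys : List A) f → ∑ (xs ++ ys) f ≡ ∑ xs f + ∑ ys f
∑-++ []       ys f = refl
∑-++ (x ∷ xs) ys f = trans (cong (f x +_) (∑-++ xs ys f)) (sym (+-assoc (f x) _ _))

∑-map : ∀ (g : A → B) xs f → ∑ (map g xs) f ≡ ∑ xs (f ∘ g)
∑-map g []       f = refl
∑-map g (x ∷ xs) f = cong (f (g x) +_) (∑-map g xs f)

∑-cartesianProductWith : ∀ {C : Set} (g : A → B → C) xs ys f →
  ∑ (cartesianProductWith g xs ys) f ≡ ∑ xs (λ x → ∑ ys (λ y → f (g x y)))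
∑-cartesianProductWith g []       ys f = refl
∑-cartesianProductWith g (x ∷ xs) ys f = trans (∑-++ (map (g x) ys) _ f)
  (cong₂ _+_ (∑-map (g x) ys f) (∑-cartesianProductWith g xs ys f))

∑-↭ : ∀ {xs ys : List A} f → xs ↭ ys → ∑ xs f ≡ ∑ ys f
∑-↭ f Perm.refl          = refl
∑-↭ f (Perm.prep x p)    = cong (f x +_) (∑-↭ f p)
∑-↭ f (Perm.swap x y p)  = trans (cong (λ s → f x + (f y + s)) (∑-↭ f p)) (lemma (f x) (f y) _)
  where
  lemma : ∀ a b c → a + (b + c) ≡ b + (a + c)
  lemma = solve-∀
∑-↭ f (Perm.trans p q)   = trans (∑-↭ f p) (∑-↭ f q)

∑∑-cons : ∀ (x : A) xs (f : A → A → ℕ) →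
  ∑ (x ∷ xs) (λ y → ∑ (x ∷ xs) (f y)) ≡
  f x x + ∑ xs (f x) + ∑ xs (λ y → f y x) + ∑ xs (λ y → ∑ xs (f y))
∑∑-cons x xs f = trans (cong (f x x + ∑ xs (f x) +_) (∑-+ xs (λ y → f y x) _))
  (sym (+-assoc (f x x + ∑ xs (f x)) _ _))

-- Two elementary inequalities

2ab≤a²+b² : ∀ a b → 2 * (a * b) ≤ a * a + b * b
2ab≤a²+b² a b = [ ordered , flipped ]′ (≤-total a b)
  where
  -- With b = a + d, the two sides differ by d², which avoids subtraction.
  square : ∀ a d → 2 * (a * (a + d)) + d * d ≡ a * a + (a + d) * (a + d)
  square = solve-∀
  ordered : ∀ {a b} → a ≤ b → 2 * (a * b) ≤ a * a + b * b
  ordered {a} a≤b with d , refl ← m≤n⇒∃[o]m+o≡n a≤b = m+n≤o⇒m≤o _ (≤-reflexive (square a d))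
  flipped : b ≤ a → 2 * (a * b) ≤ a * a + b * b
  flipped b≤a = subst₂ _≤_ (cong (2 *_) (*-comm b a)) (+-comm (b * b) _) (ordered b≤a)

-- Cancelling x, this is a quadratic form with discriminant m² ∸ 12 k².
cubic-step : ∀ m k .{{_ : NonZero k}} → m * m ≤ 12 * (k * k) → ∀ x s →
  (m + 3 * k) * (x * x * s) + k * (s * s * s) ≤ k * ((x + s) * (x + s) * (x + s))
cubic-step m k@(suc _) m²≤12k² x s = begin
  (m + 3 * k) * (x * x * s) + k * (s * s * s)
    ≡⟨ split m k x s ⟩
  x * (m * (x * s)) + (3 * k * (x * x * s) + k * (s * s * s))
    ≤⟨ +-monoˡ-≤ _ (*-monoʳ-≤ x (*-cancelˡ-≤ (4 * k) quadratic)) ⟩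
  x * (k * (x * x) + 3 * k * (s * s)) + (3 * k * (x * x * s) + k * (s * s * s))
    ≡⟨ cube k x s ⟩
  k * ((x + s) * (x + s) * (x + s)) ∎
  where
  open ≤-Reasoning
  split : ∀ m k x s → (m + 3 * k) * (x * x * s) + k * (s * s * s) ≡
    x * (m * (x * s)) + (3 * k * (x * x * s) + k * (s * s * s))
  split = solve-∀
  cube : ∀ k x s → x * (k * (x * x) + 3 * k * (s * s)) + (3 * k * (x * x * s) + k * (s * s * s)) ≡
    k * ((x + s) * (x + s) * (x + s))
  cube = solve-∀
  scale₁ : ∀ m k x s → 4 * k * (m * (x * s)) ≡ 2 * (2 * k * x * (m * s))
  scale₁ = solve-∀
  scale₂ : ∀ m k x s → 2 * k * x * (2 * k * x) + m * s * (m * s) ≡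
    4 * (k * k) * (x * x) + m * m * (s * s)
  scale₂ = solve-∀
  scale₃ : ∀ k x s → 4 * (k * k) * (x * x) + 12 * (k * k) * (s * s) ≡
    4 * k * (k * (x * x) + 3 * k * (s * s))
  scale₃ = solve-∀
  -- The factor 4k completes the square: 4k · m x s is twice the product of 2kx and ms. The
  -- resulting m² s² is then at most 12 k² s² by `m²≤12k²`.
  quadratic : 4 * k * (m * (x * s)) ≤ 4 * k * (k * (x * x) + 3 * k * (s * s))
  quadratic = begin
    4 * k * (m * (x * s))                       ≡⟨ scale₁ m k x s ⟩
    2 * (2 * k * x * (m * s))                   ≤⟨ 2ab≤a²+b² (2 * k * x) (m * s) ⟩
    2 * k * x * (2 * k * x) + m * s * (m * s)   ≡⟨ scale₂ m k x s ⟩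
    4 * (k * k) * (x * x) + m * m * (s * s)
      ≤⟨ +-monoʳ-≤ (4 * (k * k) * (x * x)) (*-monoˡ-≤ (s * s) m²≤12k²) ⟩
    4 * (k * k) * (x * x) + 12 * (k * k) * (s * s) ≡⟨ scale₃ k x s ⟩
    4 * k * (k * (x * x) + 3 * k * (s * s)) ∎

-- Weighted star counts

⟦_⟧ : Bool → ℕ
⟦ true  ⟧ = 1
⟦ false ⟧ = 0

⟦_⟧≤1 : ∀ b → ⟦ b ⟧ ≤ 1
⟦ true  ⟧≤1 = ≤-refl
⟦ false ⟧≤1 = z≤n

module Stars {V : Set} (E : V → V → Bool) where

  -- The two leaves are allowed to coincide.
  star : V → V → V → ℕ
  star a b c = ⟦ E a b ⟧ * ⟦ E a c ⟧ * ⟦ not (E b c) ∧ not (E c b) ⟧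

  star-comm : ∀ a b c → star a b c ≡ star a c b
  star-comm a b c with E a b | E a c | E b c | E c b
  ... | true  | true  | true  | true  = refl
  ... | true  | true  | true  | false = refl
  ... | true  | true  | false | true  = refl
  ... | true  | true  | false | false = refl
  ... | true  | false | _ | _ = refl
  ... | false | true  | _ | _ = refl
  ... | false | false | _ | _ = refl

  star≤1 : ∀ a b c → star a b c ≤ 1
  star≤1 a b c =
    *-mono-≤ (*-mono-≤ ⟦ E a b ⟧≤1 ⟦ E a c ⟧≤1) ⟦ not (E b c) ∧ not (E c b) ⟧≤1

  star-no-edgeˡ : ∀ {a b} c → E a b ≡ false → star a b c ≡ 0
  star-no-edgeˡ c eq rewrite eq = refl

  star-no-edgeʳ : ∀ {a c} b → E a c ≡ false → star a b c ≡ 0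
  star-no-edgeʳ {a} {c} b eq = trans (star-comm a b c) (star-no-edgeˡ b eq)

  star-diag≤ : ∀ a b → star a b b ≤ ⟦ E a b ⟧
  star-diag≤ a b with E a b | E b b
  ... | true  | true  = z≤n
  ... | true  | false = ≤-refl
  ... | false | _     = z≤n

  -- The negation of the last factor of `star`, so that adjacent leaves annihilate a star by
  -- rewriting.
  Adjacent : V → V → Set
  Adjacent b c = not (E b c) ∧ not (E c b) ≡ false

  star-adjacent : ∀ a {b c} → Adjacent b c → star a b c ≡ 0
  star-adjacent a {b} {c} eq rewrite eq = *-zeroʳ (⟦ E a b ⟧ * ⟦ E a c ⟧)

  adjacent-sym : ∀ {b c} → Adjacent b c → Adjacent c b
  adjacent-sym {b} {c} = trans (∧-comm (not (E c b)) (not (E b c)))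

  -- A list, so that inductions can run on its length. A vertex may be repeated; its occurrences
  -- then act as non-adjacent twins when `E` is irreflexive.
  Weighted : Set
  Weighted = List (V × ℕ)

  Adjacentʷ : V × ℕ → V × ℕ → Set
  Adjacentʷ (u , _) (v , _) = Adjacent u v

  weight : Weighted → ℕ
  weight W = ∑ W proj₂

  -- The cubic form whose value at a weighting w is the number of stars in the
  -- blow-up replacing every vertex v by w v independent copies.
  stars : Weighted → ℕ
  stars W = ∑ W λ (a , α) → ∑ W λ (b , β) → ∑ W λ (c , γ) → α * (β * (γ * star a b c))

  -- The coefficients of `stars ((u , α) ∷ W)` as a polynomial in α: u is the centre, or one leaf
  -- (in two possible slots, hence the factor 2 in `linear`), or both leaves (`bileafed u u`). For
  -- two vertices, `bileafed u v` is the mixed coefficient.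
  centred leafed : V → Weighted → ℕ
  centred u W = ∑ W λ (b , β) → ∑ W λ (c , γ) → β * (γ * star u b c)
  leafed  u W = ∑ W λ (a , α) → ∑ W λ (c , γ) → α * (γ * star a u c)

  linear : V → Weighted → ℕ
  linear u W = centred u W + 2 * leafed u W

  bileafed : V → V → Weighted → ℕ
  bileafed u v W = ∑ W λ (a , α) → α * star a u v

  stars-↭ : ∀ {W W′} → W ↭ W′ → stars W ≡ stars W′
  stars-↭ {W} {W′} p = trans (∑-↭ _ p) (∑-cong W′ λ _ → trans (∑-↭ _ p) (∑-cong W′ λ _ → ∑-↭ _ p))

  module _ (irrefl : ∀ v → E v v ≡ false) where

    -- The cubic form is only quadratic in α: by irreflexivity a star centred at u has no leaf at u,
    -- so u fills the centre alone, one of the two leaf slots, or both of them.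
    stars-cons : ∀ u α W →
      stars ((u , α) ∷ W) ≡ stars W + α * linear u W + α * α * bileafed u u W
    stars-cons u α W = begin
      stars ((u , α) ∷ W)
        ≡⟨ cong₂ _+_ head-part tail-part ⟩
      α * centred u W + (α * α * bileafed u u W + α * leafed u W + α * leafed u W + stars W)
        ≡⟨ lemma α (centred u W) (leafed u W) (bileafed u u W) (stars W) ⟩
      stars W + α * linear u W + α * α * bileafed u u W ∎
      where
      open ≡-Reasoning
      lemma : ∀ α c l d s →
        α * c + (α * α * d + α * l + α * l + s) ≡ s + α * (c + 2 * l) + α * α * d
      lemma = solve-∀

      vanish : ∀ i j k {s} → s ≡ 0 → i * (j * (k * s)) ≡ 0
      vanish i j k refl = trans (cong (λ t → i * (j * t)) (*-zeroʳ k))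
                         (trans (cong (i *_) (*-zeroʳ j)) (*-zeroʳ i))

      head-part : ∑ ((u , α) ∷ W) (λ (b , β) → ∑ ((u , α) ∷ W) λ (c , γ) →
                    α * (β * (γ * star u b c))) ≡ α * centred u W
      head-part = begin
        _ ≡⟨ ∑∑-cons (u , α) W (λ (b , β) (c , γ) → α * (β * (γ * star u b c))) ⟩
        _ ≡⟨ cong₂ _+_ (cong₂ _+_ (cong₂ _+_
               (vanish α α α (star-no-edgeˡ u (irrefl u)))
               (trans (∑-cong W λ (c , γ) → vanish α α γ (star-no-edgeˡ c (irrefl u))) (∑-zero W)))
               (trans (∑-cong W λ (b , β) → vanish α β α (star-no-edgeʳ b (irrefl u))) (∑-zero W)))
               (trans (∑-cong W λ (b , β) → ∑-* W α _) (∑-* W α _)) ⟩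
        α * centred u W ∎

      tail-part : ∑ W (λ (a , δ) → ∑ ((u , α) ∷ W) λ (b , β) → ∑ ((u , α) ∷ W) λ (c , γ) →
                    δ * (β * (γ * star a b c))) ≡
                  α * α * bileafed u u W + α * leafed u W + α * leafed u W + stars W
      tail-part = begin
        _ ≡⟨ ∑-cong W (λ (a , δ) →
               trans (∑∑-cons (u , α) W (λ (b , β) (c , γ) → δ * (β * (γ * star a b c))))
                     (cong₂ _+_ (cong₂ _+_ (cong₂ _+_ (rearr₁ δ α (star a u u)) (leaf₁ a δ)) (leaf₂ a δ)) refl)) ⟩
        _ ≡⟨ trans (∑-+ W _ _) (cong (_+ stars W)
            (trans (∑-+ W _ _) (cong₂ _+_
            (trans (∑-+ W _ _) (cong₂ _+_ (∑-* W (α * α) _) (∑-* W α _))) (∑-* W α _)))) ⟩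
        _ ∎
        where
        rearr₁ : ∀ δ α s → δ * (α * (α * s)) ≡ α * α * (δ * s)
        rearr₁ = solve-∀
        rearr₂ : ∀ δ α γ s → δ * (α * (γ * s)) ≡ α * (δ * (γ * s))
        rearr₂ = solve-∀
        rearr₃ : ∀ δ α β s → δ * (β * (α * s)) ≡ α * (δ * (β * s))
        rearr₃ = solve-∀
        leaf₁ : ∀ a δ → ∑ W (λ (c , γ) → δ * (α * (γ * star a u c))) ≡
                α * ∑ W (λ (c , γ) → δ * (γ * star a u c))
        leaf₁ a δ = trans (∑-cong W λ (c , γ) → rearr₂ δ α γ _) (∑-* W α _)
        leaf₂ : ∀ a δ → ∑ W (λ (b , β) → δ * (β * (α * star a b u))) ≡
                α * ∑ W (λ (c , γ) → δ * (γ * star a u c))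
        leaf₂ a δ = trans (∑-cong W λ (b , β) →
            trans (cong (λ s → δ * (β * (α * s))) (star-comm a b u)) (rearr₃ δ α β _))
          (∑-* W α _)

    -- Neither of two non-adjacent vertices can be the centre of a star with the other as a leaf, so
    -- the only new stars have u and v as their two leaves.
    linear-cons : ∀ {u v} → E u v ≡ false → E v u ≡ false → ∀ β R →
      linear u ((v , β) ∷ R) ≡ linear u R + 2 * (β * bileafed u v R)
    linear-cons {u} {v} u↛v v↛u β R = begin
      centred u ((v , β) ∷ R) + 2 * leafed u ((v , β) ∷ R)
        ≡⟨ cong₂ (λ c l → c + 2 * l) centred≡ leafed≡ ⟩
      centred u R + 2 * (β * bileafed u v R + leafed u R)
        ≡⟨ lemma (centred u R) (β * bileafed u v R) (leafed u R) ⟩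
      linear u R + 2 * (β * bileafed u v R) ∎
      where
      open ≡-Reasoning
      lemma : ∀ c d l → c + 2 * (d + l) ≡ c + 2 * l + 2 * d
      lemma = solve-∀
      vanish : ∀ i j {s} → s ≡ 0 → i * (j * s) ≡ 0
      vanish i j refl = trans (cong (i *_) (*-zeroʳ j)) (*-zeroʳ i)
      swap : ∀ i j s → i * (j * s) ≡ j * (i * s)
      swap = solve-∀
      centred≡ : centred u ((v , β) ∷ R) ≡ centred u R
      centred≡ = trans (∑∑-cons (v , β) R (λ (b , β) (c , γ) → β * (γ * star u b c)))
        (cong (_+ centred u R) (cong₂ _+_ (cong₂ _+_
          (vanish β β (star-no-edgeˡ v u↛v))
          (trans (∑-cong R λ (c , γ) → vanish β γ (star-no-edgeˡ c u↛v)) (∑-zero R)))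
          (trans (∑-cong R λ (b , γ) → vanish γ β (star-no-edgeʳ b u↛v)) (∑-zero R))))
      leafed≡ : leafed u ((v , β) ∷ R) ≡ β * bileafed u v R + leafed u R
      leafed≡ = trans (∑∑-cons (v , β) R (λ (a , α) (c , γ) → α * (γ * star a u c)))
        (cong (_+ leafed u R) (cong₂ _+_ (cong₂ _+_
          (vanish β β (star-no-edgeˡ v v↛u))
          (trans (∑-cong R λ (c , γ) → vanish β γ (star-no-edgeˡ c v↛u)) (∑-zero R)))
          (trans (∑-cong R λ (a , α) → swap α β (star a u v)) (∑-* R β _))))

    -- A vertex that is the centre of a star with leaves u and v sends edges to both, so it is also
    -- the centre of the degenerate stars at u and at v. Twice the difference of the two sides is
    -- the second derivative of the star count along the segment in `merge`.
    2bileafed≤ : ∀ u v R → 2 * bileafed u v R ≤ bileafed u u R + bileafed v v R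
    2bileafed≤ u v R = begin
      2 * bileafed u v R ≡⟨ ∑-* R 2 _ ⟨
      ∑ R (λ (a , α) → 2 * (α * star a u v)) ≤⟨ ∑-mono R (λ (a , α) → pointwise a α) ⟩
      ∑ R (λ (a , α) → α * star a u u + α * star a v v) ≡⟨ ∑-+ R _ _ ⟩
      bileafed u u R + bileafed v v R ∎
      where
      open ≤-Reasoning
      2star≤ : ∀ a → 2 * star a u v ≤ star a u u + star a v v
      2star≤ a rewrite irrefl u | irrefl v with E a u | E a v | not (E u v) ∧ not (E v u)
      ... | true  | true  | true  = ≤-refl
      ... | true  | true  | false = z≤n
      ... | true  | false | _     = z≤n
      ... | false | true  | _     = z≤n
      ... | false | false | _     = z≤n
      rearr : ∀ α s → 2 * (α * s) ≡ α * (2 * s)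
      rearr = solve-∀
      pointwise : ∀ a α → 2 * (α * star a u v) ≤ α * star a u u + α * star a v v
      pointwise a α = begin
        2 * (α * star a u v)              ≡⟨ rearr α _ ⟩
        α * (2 * star a u v)              ≤⟨ *-monoʳ-≤ α (2star≤ a) ⟩
        α * (star a u u + star a v v)     ≡⟨ *-distribˡ-+ α _ _ ⟩
        α * star a u u + α * star a v v ∎

    -- Zykov symmetrisation: along the segment where the weights of two
    -- non-adjacent vertices have a fixed sum, the number of stars is convex.
    merge : ∀ {u v} → E u v ≡ false → E v u ≡ false → ∀ α β R →
      stars ((u , α) ∷ (v , β) ∷ R) ≤ stars ((u , α + β) ∷ R) ⊎
      stars ((u , α) ∷ (v , β) ∷ R) ≤ stars ((v , α + β) ∷ R)
    merge {u} {v} u↛v v↛u α β R = [ toʳ , toˡ ]′ (≤-total X Y)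
      where
      open ≤-Reasoning
      S = stars R
      Lu = linear u R
      Lv = linear v R
      Du = bileafed u u R
      Dv = bileafed v v R
      -- With all the weight on u the count is S + (α + β) X, and on v it is S + (α + β) Y. The
      -- chord between these values, taken at the weights α and β, is S + (α X + β Y), free of
      -- division.
      X = Lu + (α + β) * Du
      Y = Lv + (α + β) * Dv
      expand : stars ((u , α) ∷ (v , β) ∷ R) ≡
               S + β * Lv + β * β * Dv + α * (Lu + 2 * (β * bileafed u v R)) + α * α * Du
      expand = trans (stars-cons u α ((v , β) ∷ R)) (cong₂ _+_
        (cong₂ (λ s l → s + α * l) (stars-cons v β R) (linear-cons u↛v v↛u β R))
        -- The entry v adds nothing to `bileafed u u`, because v sends no edge to u.
        (cong (λ d → α * α * (β * d + Du)) (star-no-edgeˡ u v↛u) ⟨ trans ⟩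
         cong (λ d → α * α * (d + Du)) (*-zeroʳ β)))
      group : ∀ S Lu Lv Du Dv D α β →
        S + β * Lv + β * β * Dv + α * (Lu + 2 * (β * D)) + α * α * Du ≡
        S + β * Lv + β * β * Dv + α * Lu + α * α * Du + α * β * (2 * D)
      group = solve-∀
      regroup : ∀ S Lu Lv Du Dv α β →
        S + β * Lv + β * β * Dv + α * Lu + α * α * Du + α * β * (Du + Dv) ≡
        S + (α * (Lu + (α + β) * Du) + β * (Lv + (α + β) * Dv))
      regroup = solve-∀
      collect : ∀ S L D α β →
        S + (α * (L + (α + β) * D) + β * (L + (α + β) * D)) ≡
        S + (α + β) * L + (α + β) * (α + β) * D
      collect = solve-∀
      convex : stars ((u , α) ∷ (v , β) ∷ R) ≤ S + (α * X + β * Y)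
      convex = begin
        stars ((u , α) ∷ (v , β) ∷ R) ≡⟨ trans expand (group S Lu Lv Du Dv (bileafed u v R) α β) ⟩
        S + β * Lv + β * β * Dv + α * Lu + α * α * Du + α * β * (2 * bileafed u v R)
          ≤⟨ +-monoʳ-≤ (S + β * Lv + β * β * Dv + α * Lu + α * α * Du)
               (*-monoʳ-≤ (α * β) (2bileafed≤ u v R)) ⟩
        S + β * Lv + β * β * Dv + α * Lu + α * α * Du + α * β * (Du + Dv)
          ≡⟨ regroup S Lu Lv Du Dv α β ⟩
        S + (α * X + β * Y) ∎
      toˡ : Y ≤ X → _
      toˡ Y≤X = inj₁ (begin
        stars ((u , α) ∷ (v , β) ∷ R) ≤⟨ convex ⟩
        S + (α * X + β * Y)           ≤⟨ +-monoʳ-≤ S (+-monoʳ-≤ (α * X) (*-monoʳ-≤ β Y≤X)) ⟩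
        S + (α * X + β * X)           ≡⟨ collect S Lu Du α β ⟩
        S + (α + β) * Lu + (α + β) * (α + β) * Du ≡⟨ stars-cons u (α + β) R ⟨
        stars ((u , α + β) ∷ R) ∎)
      toʳ : X ≤ Y → _
      toʳ X≤Y = inj₂ (begin
        stars ((u , α) ∷ (v , β) ∷ R) ≤⟨ convex ⟩
        S + (α * X + β * Y)           ≤⟨ +-monoʳ-≤ S (+-monoˡ-≤ (β * Y) (*-monoʳ-≤ α X≤Y)) ⟩
        S + (α * Y + β * Y)           ≡⟨ collect S Lv Dv α β ⟩
        S + (α + β) * Lv + (α + β) * (α + β) * Dv ≡⟨ stars-cons v (α + β) R ⟨
        stars ((v , α + β) ∷ R) ∎)

    -- Weighted tournaments

    module _ (asym : ∀ u v → E u v ≡ true → E v u ≡ false) where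

      -- Distinct entries are adjacent, so a star at u must have coinciding leaves. Only the squares
      -- β² of the weights remain, and one factor of each square is at most α.
      centred-tournament : ∀ u {α W} → AllPairs Adjacentʷ W → All (λ q → proj₂ q ≤ α) W →
        centred u W ≤ α * ∑ W (λ (b , β) → β * ⟦ E u b ⟧)
      centred-tournament u []          []          = z≤n
      centred-tournament u {α} {(b , β) ∷ W} (adj ∷ adjs) (β≤α ∷ bounds) = begin
        centred u ((b , β) ∷ W)
          ≡⟨ ∑∑-cons (b , β) W (λ (b , β) (c , γ) → β * (γ * star u b c)) ⟩
        β * (β * star u b b) + ∑ W (λ (c , γ) → β * (γ * star u b c))
          + ∑ W (λ (c , γ) → γ * (β * star u c b)) + centred u W
          ≡⟨ cong (_+ centred u W) (cong₂ (λ s t → β * (β * star u b b) + s + t)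
               (trans (∑-cong-All (All.map (λ {(c , γ)} e → vanish β γ (star-adjacent u e)) adj)) (∑-zero W))
               (trans (∑-cong-All (All.map
                 (λ {(c , γ)} e → vanish γ β (star-adjacent u (adjacent-sym e))) adj)) (∑-zero W))) ⟩
        β * (β * star u b b) + 0 + 0 + centred u W
          ≡⟨ cong (_+ centred u W) (trans (+-identityʳ _) (+-identityʳ _)) ⟩
        β * (β * star u b b) + centred u W
          ≤⟨ +-mono-≤ (*-mono-≤ β≤α (*-monoʳ-≤ β (star-diag≤ u b))) (centred-tournament u adjs bounds) ⟩
        α * (β * ⟦ E u b ⟧) + α * ∑ W (λ (b , β) → β * ⟦ E u b ⟧)
          ≡⟨ *-distribˡ-+ α (β * ⟦ E u b ⟧) _ ⟨
        α * (β * ⟦ E u b ⟧ + ∑ W (λ (b , β) → β * ⟦ E u b ⟧)) ∎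
        where
        open ≤-Reasoning
        vanish : ∀ i j {s} → s ≡ 0 → i * (j * s) ≡ 0
        vanish i j refl = trans (cong (i *_) (*-zeroʳ j)) (*-zeroʳ i)

      -- A star with exactly one leaf at u would have two adjacent leaves. What is lost with u is
      -- therefore α² times the weight of the in-neighbours, from stars with both leaves at u, and
      -- at most α² times that of the out-neighbours, from stars centred at u. By asymmetry the two
      -- weights add up to at most `weight W`.
      peel : ∀ {u α W} → AllPairs Adjacentʷ ((u , α) ∷ W) → All (λ q → proj₂ q ≤ α) W →
        stars ((u , α) ∷ W) ≤ stars W + α * α * weight W
      peel {u} {α} {W} (adj ∷ adjs) bounds = begin
        stars ((u , α) ∷ W)
          ≡⟨ stars-cons u α W ⟩
        stars W + α * (centred u W + 2 * leafed u W) + α * α * bileafed u u W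
          ≡⟨ cong (λ l → stars W + α * (centred u W + 2 * l) + α * α * bileafed u u W) leafed≡0 ⟩
        stars W + α * (centred u W + 0) + α * α * bileafed u u W
          ≤⟨ +-mono-≤ (+-monoʳ-≤ (stars W) (*-monoʳ-≤ α (+-monoˡ-≤ 0 (centred-tournament u adjs bounds))))
               (*-monoʳ-≤ (α * α) (∑-mono W λ (a , β) → *-monoʳ-≤ β (star-diag≤ a u))) ⟩
        stars W + α * (α * out + 0) + α * α * inn
          ≡⟨ lemma (stars W) α out inn ⟩
        stars W + α * α * (out + inn)
          ≡⟨ cong (λ t → stars W + α * α * t) (∑-+ W _ _) ⟨
        stars W + α * α * ∑ W (λ (b , β) → β * ⟦ E u b ⟧ + β * ⟦ E b u ⟧)
          ≤⟨ +-monoʳ-≤ (stars W) (*-monoʳ-≤ (α * α) (∑-mono W λ (b , β) → one-way b β)) ⟩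
        stars W + α * α * weight W ∎
        where
        open ≤-Reasoning
        out = ∑ W (λ (b , β) → β * ⟦ E u b ⟧)
        inn = ∑ W (λ (b , β) → β * ⟦ E b u ⟧)
        lemma : ∀ s α o i → s + α * (α * o + 0) + α * α * i ≡ s + α * α * (o + i)
        lemma = solve-∀
        leafed≡0 : leafed u W ≡ 0
        leafed≡0 = trans (∑-cong W λ (a , β) → trans
          (∑-cong-All (All.map (λ {(c , γ)} e → trans (cong (λ s → β * (γ * s)) (star-adjacent a e))
            (trans (cong (β *_) (*-zeroʳ γ)) (*-zeroʳ β))) adj)) (∑-zero W)) (∑-zero W)
        one-way : ∀ b β → β * ⟦ E u b ⟧ + β * ⟦ E b u ⟧ ≤ β
        one-way b β with E u b in eq
        ... | true rewrite asym u b eq = ≤-reflexive (trans (cong₂ _+_ (*-identityʳ β) (*-zeroʳ β)) (+-identityʳ β))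
        ... | false = begin
          β * 0 + β * ⟦ E b u ⟧ ≤⟨ +-mono-≤ (≤-reflexive (*-zeroʳ β)) (*-monoʳ-≤ β ⟦ E b u ⟧≤1) ⟩
          β * 1                 ≡⟨ *-identityʳ β ⟩
          β ∎

  -- Reduction to tournaments

  NonAdjacentPair : Weighted → Set
  NonAdjacentPair W = Σ[ u ∈ V ] Σ[ α ∈ ℕ ] Σ[ v ∈ V ] Σ[ β ∈ ℕ ] ∃[ R ]
    W ↭ (u , α) ∷ (v , β) ∷ R × E u v ≡ false × E v u ≡ false

  adjacent-or-not : ∀ u W →
    All (λ q → Adjacent u (proj₁ q)) W ⊎
    (Σ[ v ∈ V ] Σ[ β ∈ ℕ ] ∃[ R ] W ↭ (v , β) ∷ R × E u v ≡ false × E v u ≡ false)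
  adjacent-or-not u [] = inj₁ []
  adjacent-or-not u ((v , β) ∷ W) with E u v in uv | E v u in vu | adjacent-or-not u W
  ... | false | false | _         = inj₂ (v , β , W , ↭-refl , uv , vu)
  ... | _     | _     | inj₂ (w , γ , R , p , uw , wu) =
    inj₂ (w , γ , (v , β) ∷ R , ↭-trans (↭-prep _ p) (↭-swap _ _ ↭-refl) , uw , wu)
  ... | true  | _     | inj₁ adj  = inj₁ (cong (λ b → not b ∧ not (E v u)) uv ∷ adj)
  ... | false | true  | inj₁ adj  = inj₁ (cong₂ (λ b c → not b ∧ not c) uv vu ∷ adj)

  tournament-or-not : ∀ W →
    AllPairs Adjacentʷ W ⊎ NonAdjacentPair W
  tournament-or-not [] = inj₁ []
  tournament-or-not ((u , α) ∷ W) with adjacent-or-not u W | tournament-or-not W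
  ... | inj₂ (v , β , R , p , uv , vu) | _ = inj₂ (u , α , v , β , R , ↭-prep _ p , uv , vu)
  ... | _ | inj₂ (v , β , w , γ , R , p , vw , wv) = inj₂ (v , β , w , γ , (u , α) ∷ R ,
    ↭-trans (↭-prep _ p) (↭-trans (↭-swap _ _ ↭-refl) (↭-prep _ (↭-swap _ _ ↭-refl))) , vw , wv)
  ... | inj₁ adj | inj₁ adjs = inj₁ (adj ∷ adjs)

  heaviest : ∀ p W → Σ[ u ∈ V ] Σ[ α ∈ ℕ ] ∃[ R ] p ∷ W ↭ (u , α) ∷ R × All (λ q → proj₂ q ≤ α) R
  heaviest (u , α) [] = u , α , [] , ↭-refl , []
  heaviest (u , α) (q ∷ W) with heaviest q W
  ... | v , β , R , p , bounds with ≤-total α β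
  ...   | inj₁ α≤β = v , β , (u , α) ∷ R ,
            ↭-trans (↭-prep _ p) (↭-swap _ _ ↭-refl) , α≤β ∷ bounds
  ...   | inj₂ β≤α = u , α , (v , β) ∷ R , ↭-prep _ p , β≤α ∷ All.map (λ γ≤β → ≤-trans γ≤β β≤α) bounds

  -- Induction on the length of the list, which drops by one in both branches. A merge preserves the
  -- total weight and does not decrease the count; in a tournament `peel` removes the heaviest entry
  -- and `cubic-step` absorbs the loss.
  stars-bound : (∀ v → E v v ≡ false) → (∀ u v → E u v ≡ true → E v u ≡ false) →
    ∀ m k .{{_ : NonZero k}} → m * m ≤ 12 * (k * k) →
    ∀ W → (m + 3 * k) * stars W ≤ k * (weight W * weight W * weight W)
  stars-bound irrefl asym m k m²≤12k² W = go (length W) W refl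
    where
    open ≤-Reasoning
    c = m + 3 * k
    cube : Weighted → ℕ
    cube W = weight W * weight W * weight W
    cube-↭ : ∀ {W W′} → W ↭ W′ → cube W ≡ cube W′
    cube-↭ p = cong (λ s → s * s * s) (∑-↭ proj₂ p)
    go : ∀ l W → length W ≡ l → c * stars W ≤ k * cube W
    go l       []      eq = ≤-trans (≤-reflexive (*-zeroʳ c)) z≤n
    go (suc l) (p ∷ W) eq with heaviest p W
    -- The heaviest entry goes to the front before the test, since `peel` needs it to dominate the
    -- others.
    ... | u , α , R , perm , bounds with tournament-or-not ((u , α) ∷ R)
    ...   | inj₁ adjs = begin
      c * stars (p ∷ W)       ≡⟨ cong (c *_) (stars-↭ perm) ⟩
      c * stars ((u , α) ∷ R) ≤⟨ *-monoʳ-≤ c (peel irrefl asym adjs bounds) ⟩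
      c * (stars R + α * α * weight R) ≡⟨ *-distribˡ-+ c (stars R) _ ⟩
      c * stars R + c * (α * α * weight R)
        ≤⟨ +-monoˡ-≤ _ (go l R (suc-injective (trans (sym (↭-length perm)) eq))) ⟩
      k * cube R + c * (α * α * weight R) ≡⟨ +-comm (k * cube R) _ ⟩
      c * (α * α * weight R) + k * cube R ≤⟨ cubic-step m k m²≤12k² α (weight R) ⟩
      k * cube ((u , α) ∷ R)   ≡⟨ cong (k *_) (cube-↭ perm) ⟨
      k * cube (p ∷ W) ∎
    ...   | inj₂ (v , β , w , γ , S , perm′ , vw , wv) =
      [ merged v , merged w ]′ (merge irrefl vw wv β γ S)
      where
      perm″ = ↭-trans perm perm′
      merged : ∀ x → stars ((v , β) ∷ (w , γ) ∷ S) ≤ stars ((x , β + γ) ∷ S) →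
               c * stars (p ∷ W) ≤ k * cube (p ∷ W)
      merged x le = begin
        c * stars (p ∷ W)                  ≡⟨ cong (c *_) (stars-↭ perm″) ⟩
        c * stars ((v , β) ∷ (w , γ) ∷ S)  ≤⟨ *-monoʳ-≤ c le ⟩
        c * stars ((x , β + γ) ∷ S)
          ≤⟨ go l ((x , β + γ) ∷ S) (suc-injective (trans (sym (↭-length perm″)) eq)) ⟩
        k * cube ((x , β + γ) ∷ S)
          ≡⟨ cong (λ s → k * (s * s * s)) (trans (+-assoc β γ _) (sym (∑-↭ proj₂ perm″))) ⟩
        k * cube (p ∷ W) ∎

open Stars using (star)

-- Sums over maps and over distinct vertices

-- The map sending v and x to `v [ i ]≔ x` reaches every vector `length xs` times: a uniform vector
-- stays uniform when one coordinate is redrawn.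
resample : ∀ (xs : List A) {N} (i : Fin N) (h : Vec A N → ℕ) →
  length xs * ∑ (vecs xs N) h ≡ ∑ (vecs xs N) λ v → ∑ xs λ x → h (v [ i ]≔ x)
resample xs {suc N} zero h = begin
  length xs * ∑ (vecs xs (suc N)) h
    ≡⟨ cong (length xs *_) (trans (∑-cartesianProductWith _∷_ xs (vecs xs N) h)
                                  (∑-comm xs (vecs xs N) (λ x v → h (x ∷ v)))) ⟩
  length xs * ∑ (vecs xs N) (λ v → ∑ xs λ x → h (x ∷ v))
    ≡⟨ ∑-const xs _ ⟨
  ∑ xs (λ y → ∑ (vecs xs N) λ v → ∑ xs λ x → h (x ∷ v))
    ≡⟨ ∑-cartesianProductWith _∷_ xs (vecs xs N) (λ v → ∑ xs λ x → h (v [ zero ]≔ x)) ⟨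
  ∑ (vecs xs (suc N)) (λ v → ∑ xs λ x → h (v [ zero ]≔ x)) ∎
  where open ≡-Reasoning
resample xs {suc N} (suc i) h = begin
  length xs * ∑ (vecs xs (suc N)) h
    ≡⟨ cong (length xs *_) (∑-cartesianProductWith _∷_ xs (vecs xs N) h) ⟩
  length xs * ∑ xs (λ y → ∑ (vecs xs N) λ v → h (y ∷ v))
    ≡⟨ ∑-* xs (length xs) _ ⟨
  ∑ xs (λ y → length xs * ∑ (vecs xs N) λ v → h (y ∷ v))
    ≡⟨ ∑-cong xs (λ y → resample xs i (λ v → h (y ∷ v))) ⟩
  ∑ xs (λ y → ∑ (vecs xs N) λ v → ∑ xs λ x → h (y ∷ v [ i ]≔ x))
    ≡⟨ ∑-cartesianProductWith _∷_ xs (vecs xs N) (λ v → ∑ xs λ x → h (v [ suc i ]≔ x)) ⟨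
  ∑ (vecs xs (suc N)) (λ v → ∑ xs λ x → h (v [ suc i ]≔ x)) ∎
  where open ≡-Reasoning

-- Three distinct coordinates of a uniform vector are independent and uniform; the identity is this
-- statement with the denominators cleared.
resample³ : ∀ (xs : List A) {N} {i j k : Fin N} → i ≢ j → i ≢ k → j ≢ k → (f : A → A → A → ℕ) →
  length xs * (length xs * (length xs *
    ∑ (vecs xs N) λ v → f (lookup v i) (lookup v j) (lookup v k))) ≡
  length (vecs xs N) * ∑ xs λ x → ∑ xs λ y → ∑ xs λ z → f x y z
resample³ {A} xs {N} {i} {j} {k} i≢j i≢k j≢k f = begin
  l * (l * (l * ∑ (vecs xs N) h))
    ≡⟨ cong (λ s → l * (l * s)) (resample xs k h) ⟩
  l * (l * ∑ (vecs xs N) λ v → ∑ xs λ z → h (v [ k ]≔ z))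
    ≡⟨ cong (l *_) (resample xs j _) ⟩
  l * (∑ (vecs xs N) λ v → ∑ xs λ y → ∑ xs λ z → h ((v [ j ]≔ y) [ k ]≔ z))
    ≡⟨ resample xs i _ ⟩
  ∑ (vecs xs N) (λ v → ∑ xs λ x → ∑ xs λ y → ∑ xs λ z → h (((v [ i ]≔ x) [ j ]≔ y) [ k ]≔ z))
    ≡⟨ ∑-cong (vecs xs N) (λ v → ∑-cong xs λ x → ∑-cong xs λ y → ∑-cong xs λ z → evaluate v x y z) ⟩
  ∑ (vecs xs N) (λ _ → ∑ xs λ x → ∑ xs λ y → ∑ xs λ z → f x y z)
    ≡⟨ ∑-const (vecs xs N) _ ⟩
  length (vecs xs N) * (∑ xs λ x → ∑ xs λ y → ∑ xs λ z → f x y z) ∎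
  where
  open ≡-Reasoning
  l = length xs
  h : Vec A N → ℕ
  h v = f (lookup v i) (lookup v j) (lookup v k)
  -- Since i, j and k are distinct, no later update overwrites an earlier one.
  evaluate : ∀ v x y z → h (((v [ i ]≔ x) [ j ]≔ y) [ k ]≔ z) ≡ f x y z
  evaluate v x y z
    rewrite lookup∘update k ((v [ i ]≔ x) [ j ]≔ y) z
          | lookup∘update′ j≢k ((v [ i ]≔ x) [ j ]≔ y) z
          | lookup∘update j (v [ i ]≔ x) y
          | lookup∘update′ i≢k ((v [ i ]≔ x) [ j ]≔ y) z
          | lookup∘update′ i≢j (v [ i ]≔ x) y
          | lookup∘update i v x = refl

-- Despite the letter, the complement of the Kronecker delta: it is 0 on the diagonal.
δ : Fin n → Fin n → ℕ
δ i j = ⟦ not (does (i Fin.≟ j)) ⟧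

∑-allFin-suc : ∀ (f : Fin (suc n) → ℕ) → ∑ (allFin (suc n)) f ≡ f zero + ∑ (allFin n) (f ∘ suc)
∑-allFin-suc {n} f = cong (f zero +_)
  (trans (cong (λ xs → ∑ xs f) (sym (map-tabulate id suc))) (∑-map suc (allFin n) f))

∑-single : ∀ (i : Fin n) → ∑ (allFin n) (λ k → ⟦ does (i Fin.≟ k) ⟧) ≡ 1
∑-single {suc n} zero    = trans (∑-allFin-suc {n} (λ k → ⟦ does (zero Fin.≟ k) ⟧)) (cong suc (∑-zero (allFin n)))
∑-single {suc n} (suc i) = trans (∑-allFin-suc (λ k → ⟦ does (suc i Fin.≟ k) ⟧)) (∑-single i)

length-allFin : ∀ n → length (allFin n) ≡ n
length-allFin n = length-tabulate {n = n} id

∑-ones : ∀ n → ∑ (allFin n) (λ _ → 1) ≡ n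
∑-ones n = trans (∑-const (allFin n) 1) (trans (*-identityʳ _) (length-allFin n))

∑-avoid₁ : ∀ (i : Fin (suc n)) → ∑ (allFin (suc n)) (δ i) ≡ n
∑-avoid₁ {n} i = suc-injective (begin
  1 + ∑ V (δ i)
    ≡⟨ cong (_+ ∑ V (δ i)) (∑-single i) ⟨
  ∑ V (λ k → ⟦ does (i Fin.≟ k) ⟧) + ∑ V (δ i)
    ≡⟨ ∑-+ V (λ k → ⟦ does (i Fin.≟ k) ⟧) (δ i) ⟨
  ∑ V (λ k → ⟦ does (i Fin.≟ k) ⟧ + δ i k)
    ≡⟨ ∑-cong V (λ k → complement (does (i Fin.≟ k))) ⟩
  ∑ V (λ _ → 1)
    ≡⟨ ∑-ones (suc n) ⟩
  suc n ∎)
  where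
  open ≡-Reasoning
  V = allFin (suc n)
  complement : ∀ b → ⟦ b ⟧ + ⟦ not b ⟧ ≡ 1
  complement true  = refl
  complement false = refl

∑-avoid₂ : ∀ {i j : Fin (suc (suc n))} → i ≢ j → ∑ (allFin (suc (suc n))) (λ k → δ i k * δ j k) ≡ n
∑-avoid₂ {n} {i} {j} i≢j = suc-injective (begin
  1 + ∑ V (λ k → δ i k * δ j k)
    ≡⟨ cong (_+ ∑ V (λ k → δ i k * δ j k)) (∑-single i) ⟨
  ∑ V (λ k → ⟦ does (i Fin.≟ k) ⟧) + ∑ V (λ k → δ i k * δ j k)
    ≡⟨ ∑-+ V (λ k → ⟦ does (i Fin.≟ k) ⟧) (λ k → δ i k * δ j k) ⟨
  ∑ V (λ k → ⟦ does (i Fin.≟ k) ⟧ + δ i k * δ j k)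
    ≡⟨ ∑-cong V split ⟩
  ∑ V (δ j)
    ≡⟨ ∑-avoid₁ j ⟩
  suc n ∎)
  where
  open ≡-Reasoning
  V = allFin (suc (suc n))
  split : ∀ k → ⟦ does (i Fin.≟ k) ⟧ + δ i k * δ j k ≡ δ j k
  split k with i Fin.≟ k | j Fin.≟ k
  ... | yes refl | yes refl = contradiction refl i≢j
  ... | yes refl | no  _    = refl
  ... | no  _    | yes _    = refl
  ... | no  _    | no  _    = refl

-- The third falling factorial of n + 2, written without truncated subtraction and in the form in
-- which `6*nC3` gives 6 C(n + 2, 3).
∑-distinct : ∀ n → let V = allFin (suc (suc n)) in
  ∑ V (λ i → ∑ V λ j → ∑ V λ k → δ i j * (δ i k * δ j k)) ≡ suc (suc n) * (suc n * n)
∑-distinct n = begin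
  ∑ V (λ i → ∑ V λ j → ∑ V λ k → δ i j * (δ i k * δ j k))
    ≡⟨ ∑-cong V (λ i → ∑-cong V λ j → trans (∑-* V (δ i j) _) (inner i j)) ⟩
  ∑ V (λ i → ∑ V λ j → n * δ i j)
    ≡⟨ ∑-cong V (λ i → trans (∑-* V n _) (trans (cong (n *_) (∑-avoid₁ i)) (*-comm n (suc n)))) ⟩
  ∑ V (λ i → suc n * n)
    ≡⟨ ∑-const V (suc n * n) ⟩
  length V * (suc n * n)
    ≡⟨ cong (_* (suc n * n)) (length-allFin (suc (suc n))) ⟩
  suc (suc n) * (suc n * n) ∎
  where
  open ≡-Reasoning
  V = allFin (suc (suc n))
  inner : ∀ i j → δ i j * ∑ V (λ k → δ i k * δ j k) ≡ n * δ i j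
  inner i j with i Fin.≟ j
  ... | yes _  = sym (*-zeroʳ n)
  ... | no i≢j = trans (*-identityˡ _) (trans (∑-avoid₂ i≢j) (sym (*-identityʳ n)))

2*nC2 : ∀ n → 2 * (suc n C 2) ≡ suc n * n
2*nC2 zero    = refl
2*nC2 (suc n) = begin
  2 * (suc (suc n) C 2)            ≡⟨ cong (2 *_) (nCk+nC[k+1]≡[n+1]C[k+1] (suc n) 1) ⟨
  2 * (suc n C 1 + suc n C 2)      ≡⟨ *-distribˡ-+ 2 (suc n C 1) _ ⟩
  2 * (suc n C 1) + 2 * (suc n C 2) ≡⟨ cong₂ (λ a b → 2 * a + b) (nC1≡n (suc n)) (2*nC2 n) ⟩
  2 * suc n + suc n * n            ≡⟨ lemma n ⟩
  suc (suc n) * suc n ∎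
  where
  open ≡-Reasoning
  lemma : ∀ n → 2 * suc n + suc n * n ≡ suc (suc n) * suc n
  lemma = solve-∀

6*nC3 : ∀ n → 6 * (suc (suc n) C 3) ≡ suc (suc n) * (suc n * n)
6*nC3 zero    = refl
6*nC3 (suc n) = begin
  6 * (suc (suc (suc n)) C 3)                     ≡⟨ cong (6 *_) (nCk+nC[k+1]≡[n+1]C[k+1] (suc (suc n)) 2) ⟨
  6 * (suc (suc n) C 2 + suc (suc n) C 3)         ≡⟨ regroup (suc (suc n) C 2) (suc (suc n) C 3) ⟩
  3 * (2 * (suc (suc n) C 2)) + 6 * (suc (suc n) C 3) ≡⟨ cong₂ (λ a b → 3 * a + b) (2*nC2 (suc n)) (6*nC3 n) ⟩
  3 * (suc (suc n) * suc n) + suc (suc n) * (suc n * n) ≡⟨ lemma n ⟩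
  suc (suc (suc n)) * (suc (suc n) * suc n) ∎
  where
  open ≡-Reasoning
  regroup : ∀ a b → 6 * (a + b) ≡ 3 * (2 * a) + 6 * b
  regroup = solve-∀
  lemma : ∀ n → 3 * (suc (suc n) * suc n) + suc (suc n) * (suc n * n) ≡ suc (suc (suc n)) * (suc (suc n) * suc n)
  lemma = solve-∀

-- Counting induced stars

length-filter≡∑ : ∀ {P : A → Set} (P? : Decidable P) xs →
  length (filter P? xs) ≡ ∑ xs (λ x → ⟦ does (P? x) ⟧)
length-filter≡∑ P? []       = refl
length-filter≡∑ P? (x ∷ xs) with does (P? x)
... | true  = cong suc (length-filter≡∑ P? xs)
... | false = length-filter≡∑ P? xs

-- A relation takes the place of an injection, as the partners are only known to exist. The partner
-- of the head is deleted from `ys`, and injectivity ensures that no later element needs it.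
pigeonhole : ∀ {R : A → B → Set} {xs ys} → (∀ {x x′ y} → R x y → R x′ y → x ≡ x′) → Unique xs →
  (∀ {x} → x ∈ xs → ∃[ y ] y ∈ ys × R x y) → length xs ≤ length ys
pigeonhole injective [] total = z≤n
pigeonhole {R = R} {x ∷ xs} {ys} injective (x∉xs ∷ unique) total
  with total (here refl)
... | y , y∈ys , xRy with ∈-∃++ y∈ys
...   | us , vs , refl = ≤-trans (s≤s (pigeonhole {R = R} injective unique total′))
                                 (≤-reflexive (sym (length-++-sucʳ us y vs)))
  where
  total′ : ∀ {x′} → x′ ∈ xs → ∃[ y′ ] y′ ∈ us ++ vs × R x′ y′
  total′ x′∈xs with total (there x′∈xs)
  ... | y′ , y′∈ys , x′Ry′ with ∈-++⁻ us y′∈ys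
  ...   | inj₁ y′∈us         = y′ , ∈-++⁺ˡ y′∈us , x′Ry′
  ...   | inj₂ (there y′∈vs) = y′ , ∈-++⁺ʳ us y′∈vs , x′Ry′
  ...   | inj₂ (here refl)   = contradiction (injective xRy x′Ry′) (All.lookup x∉xs x′∈xs)

vecs-unique : ∀ {xs : List A} → Unique xs → ∀ n → Unique (vecs xs n)
vecs-unique unique zero    = [] ∷ []
vecs-unique unique (suc n) = Unique.cartesianProductWith⁺ _∷_ ∷-injective unique (vecs-unique unique n)

subsets-unique : ∀ n → Unique (subsets n)
subsets-unique = vecs-unique (((λ ()) ∷ []) ∷ [] ∷ [])

∣∪⁅x⁆∣ : ∀ {p : Subset n} {x} → x Subset.∉ p → ∣ p ∪ ⁅ x ⁆ ∣ ≡ suc ∣ p ∣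
∣∪⁅x⁆∣ {p = true  ∷ p} {zero}  x∉p = contradiction Vec.here x∉p
∣∪⁅x⁆∣ {p = false ∷ p} {zero}  x∉p = cong (suc ∘ ∣_∣) (∪-identityʳ p)
∣∪⁅x⁆∣ {p = true  ∷ p} {suc x} x∉p = cong suc (∣∪⁅x⁆∣ (x∉p ∘ Vec.there))
∣∪⁅x⁆∣ {p = false ∷ p} {suc x} x∉p = ∣∪⁅x⁆∣ (x∉p ∘ Vec.there)

triple : Fin n → Fin n → Fin n → Subset n
triple a b c = ⁅ a ⁆ ∪ ⁅ b ⁆ ∪ ⁅ c ⁆

∈-triple⁻ : ∀ {a b c x : Fin n} → x Subset.∈ triple a b c → x ≡ a ⊎ x ≡ b ⊎ x ≡ c
∈-triple⁻ {a = a} {b} {c} x∈ with x∈p∪q⁻ ⁅ a ⁆ _ x∈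
... | inj₁ x∈a = inj₁ (x∈⁅y⁆⇒x≡y a x∈a)
... | inj₂ x∈bc with x∈p∪q⁻ ⁅ b ⁆ _ x∈bc
...   | inj₁ x∈b = inj₂ (inj₁ (x∈⁅y⁆⇒x≡y b x∈b))
...   | inj₂ x∈c = inj₂ (inj₂ (x∈⁅y⁆⇒x≡y c x∈c))

∈-triple⁺ : ∀ {a b c x : Fin n} → x ≡ a ⊎ x ≡ b ⊎ x ≡ c → x Subset.∈ triple a b c
∈-triple⁺ (inj₁ refl)        = x∈p∪q⁺ (inj₁ (x∈⁅x⁆ _))
∈-triple⁺ {a = a} (inj₂ (inj₁ refl)) = x∈p∪q⁺ {p = ⁅ a ⁆} (inj₂ (x∈p∪q⁺ (inj₁ (x∈⁅x⁆ _))))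
∈-triple⁺ {a = a} {b} (inj₂ (inj₂ refl)) = x∈p∪q⁺ {p = ⁅ a ⁆} (inj₂ (x∈p∪q⁺ {p = ⁅ b ⁆} (inj₂ (x∈⁅x⁆ _))))

∣triple∣≡3 : ∀ {a b c : Fin n} → a ≢ b → a ≢ c → b ≢ c → ∣ triple a b c ∣ ≡ 3
∣triple∣≡3 {a = a} {b} {c} a≢b a≢c b≢c = begin
  ∣ ⁅ a ⁆ ∪ ⁅ b ⁆ ∪ ⁅ c ⁆ ∣   ≡⟨ cong ∣_∣ (∪-assoc ⁅ a ⁆ ⁅ b ⁆ ⁅ c ⁆) ⟨
  ∣ (⁅ a ⁆ ∪ ⁅ b ⁆) ∪ ⁅ c ⁆ ∣ ≡⟨ ∣∪⁅x⁆∣ c∉ab ⟩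
  suc ∣ ⁅ a ⁆ ∪ ⁅ b ⁆ ∣       ≡⟨ cong suc (∣∪⁅x⁆∣ (a≢b ∘ sym ∘ x∈⁅y⁆⇒x≡y a)) ⟩
  suc (suc ∣ ⁅ a ⁆ ∣)         ≡⟨ cong (2 +_) (∣⁅x⁆∣≡1 a) ⟩
  3 ∎
  where
  open ≡-Reasoning
  c∉ab : c Subset.∉ ⁅ a ⁆ ∪ ⁅ b ⁆
  c∉ab c∈ = [ a≢c ∘ sym ∘ x∈⁅y⁆⇒x≡y a , b≢c ∘ sym ∘ x∈⁅y⁆⇒x≡y b ]′ (x∈p∪q⁻ ⁅ a ⁆ _ c∈)

module _ (G : Orgraph n) where

  private
    E : Fin n → Fin n → Bool
    E = edge (digraph G)

    irrefl : ∀ v → E v v ≡ false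
    irrefl = proj₁ (isOrgraph G)

    asym : ∀ u v → E u v ≡ true → E v u ≡ false
    asym = proj₂ (isOrgraph G)

    V : List (Fin n)
    V = allFin n

    Vs : List (Fin n × Fin n × Fin n)
    Vs = cartesianProduct V (cartesianProduct V V)

  record IsStar (a b c : Fin n) : Set where
    constructor isStar
    field
      a→b : E a b ≡ true
      a→c : E a c ≡ true
      b↛c : E b c ≡ false
      c↛b : E c b ≡ false

  star⇒isStar : ∀ {a b c} → star E a b c ≡ 1 → IsStar a b c
  star⇒isStar {a} {b} {c} eq with E a b in ab | E a c in ac | E b c in bc | E c b in cb
  ... | true | true | false | false = isStar ab ac bc cb

  isStar⇒star : ∀ {a b c} → IsStar a b c → star E a b c ≡ 1
  isStar⇒star (isStar ab ac bc cb) rewrite ab | ac | bc | cb = refl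

  edge⇒≢ : ∀ {u v} → E u v ≡ true → u ≢ v
  edge⇒≢ uv refl = contradiction (trans (sym uv) (irrefl _)) λ ()

  -- Ordering the leaves makes the description of an induced star unique.
  OrderedStar : Fin n × Fin n × Fin n → Set
  OrderedStar (a , b , c) = star E a b c ≡ 1 × b Fin.< c

  orderedStar? : Decidable OrderedStar
  orderedStar? (a , b , c) = (star E a b c ≟ 1) ×-dec (b Fin.<? c)

  -- The correspondence between ordered stars and vertex sets; `pigeonhole` uses it in both
  -- directions.
  Spans : Fin n × Fin n × Fin n → Subset n → Set
  Spans t@(a , b , c) S = OrderedStar t × S ≡ triple a b c

  -- The centre is the only vertex of the set with an edge to another vertex of the set; the order
  -- then tells the leaves apart.
  spans-injective : ∀ {t t′ S} → Spans t S → Spans t′ S → t ≡ t′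
  spans-injective {a , b , c} {a′ , b′ , c′} ((st , b<c) , refl) ((st′ , b′<c′) , eq)
    with star⇒isStar st | star⇒isStar st′
  ... | isStar ab ac bc cb | isStar ab′ ac′ _ _ = go
    (centre (member (inj₁ refl)) (member (inj₂ (inj₁ refl))) ab′)
    (member (inj₂ (inj₁ refl))) (member (inj₂ (inj₂ refl)))
    where
    clash : ∀ {b : Bool} → b ≡ true → b ≡ false → ∀ {A : Set} → A
    clash refl ()
    member : ∀ {x} → x ≡ a′ ⊎ x ≡ b′ ⊎ x ≡ c′ → x ≡ a ⊎ x ≡ b ⊎ x ≡ c
    member {x} x∈ = ∈-triple⁻ (subst (x Subset.∈_) (sym eq) (∈-triple⁺ x∈))
    centre : ∀ {x y} → x ≡ a ⊎ x ≡ b ⊎ x ≡ c → y ≡ a ⊎ y ≡ b ⊎ y ≡ c → E x y ≡ true → x ≡ a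
    centre (inj₁ x≡a)         _                  xy = x≡a
    centre (inj₂ (inj₁ refl)) (inj₁ refl)        xy = clash xy (asym _ _ ab)
    centre (inj₂ (inj₁ refl)) (inj₂ (inj₁ refl)) xy = clash xy (irrefl _)
    centre (inj₂ (inj₁ refl)) (inj₂ (inj₂ refl)) xy = clash xy bc
    centre (inj₂ (inj₂ refl)) (inj₁ refl)        xy = clash xy (asym _ _ ac)
    centre (inj₂ (inj₂ refl)) (inj₂ (inj₁ refl)) xy = clash xy cb
    centre (inj₂ (inj₂ refl)) (inj₂ (inj₂ refl)) xy = clash xy (irrefl _)
    go : a′ ≡ a → b′ ≡ a ⊎ b′ ≡ b ⊎ b′ ≡ c → c′ ≡ a ⊎ c′ ≡ b ⊎ c′ ≡ c →
         (a , b , c) ≡ (a′ , b′ , c′)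
    go refl (inj₁ refl) _ = clash ab′ (irrefl _)
    go refl (inj₂ _) (inj₁ refl) = clash ac′ (irrefl _)
    go refl (inj₂ (inj₁ refl)) (inj₂ (inj₁ refl)) = contradiction b′<c′ (<-irrefl refl)
    go refl (inj₂ (inj₁ refl)) (inj₂ (inj₂ refl)) = refl
    go refl (inj₂ (inj₂ refl)) (inj₂ (inj₁ refl)) = contradiction b′<c′ (<-asym b<c)
    go refl (inj₂ (inj₂ refl)) (inj₂ (inj₂ refl)) = contradiction b′<c′ (<-irrefl refl)

  triple-inducesCopy : ∀ {a b c} → IsStar a b c → b ≢ c → InducesCopy (digraph K₁,₂) (digraph G) (triple a b c)
  triple-inducesCopy {a} {b} {c} (isStar ab ac bc cb) b≢c =
    ∣triple∣≡3 a≢b a≢c b≢c , f , injective , inside-triple , onto , edges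
    where
    a≢b = edge⇒≢ ab
    a≢c = edge⇒≢ ac
    f : Vec (Fin n) 3
    f = a ∷ b ∷ c ∷ []
    injective : ∀ i j → lookup f i ≡ lookup f j → i ≡ j
    injective zero zero _ = refl
    injective zero (suc zero) eq = contradiction eq a≢b
    injective zero (suc (suc zero)) eq = contradiction eq a≢c
    injective (suc zero) zero eq = contradiction (sym eq) a≢b
    injective (suc zero) (suc zero) _ = refl
    injective (suc zero) (suc (suc zero)) eq = contradiction eq b≢c
    injective (suc (suc zero)) zero eq = contradiction (sym eq) a≢c
    injective (suc (suc zero)) (suc zero) eq = contradiction (sym eq) b≢c
    injective (suc (suc zero)) (suc (suc zero)) _ = refl
    inside-triple : ∀ i → lookup f i Subset.∈ triple a b c
    inside-triple zero             = ∈-triple⁺ (inj₁ refl)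
    inside-triple (suc zero)       = ∈-triple⁺ (inj₂ (inj₁ refl))
    inside-triple (suc (suc zero)) = ∈-triple⁺ (inj₂ (inj₂ refl))
    onto : ∀ x → x Subset.∈ triple a b c → ∃[ i ] lookup f i ≡ x
    onto x x∈ with ∈-triple⁻ {a = a} {b} {c} x∈
    ... | inj₁ eq        = zero , sym eq
    ... | inj₂ (inj₁ eq) = suc zero , sym eq
    ... | inj₂ (inj₂ eq) = suc (suc zero) , sym eq
    edges : ∀ i j → E (lookup f i) (lookup f j) ≡ edge (digraph K₁,₂) i j
    edges zero zero = irrefl a
    edges zero (suc zero) = ab
    edges zero (suc (suc zero)) = ac
    edges (suc zero) zero = asym a b ab
    edges (suc zero) (suc zero) = irrefl b
    edges (suc zero) (suc (suc zero)) = bc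
    edges (suc (suc zero)) zero = asym a c ac
    edges (suc (suc zero)) (suc zero) = cb
    edges (suc (suc zero)) (suc (suc zero)) = irrefl c

  inducesCopy-spanned : ∀ {S} → InducesCopy (digraph K₁,₂) (digraph G) S → ∃[ t ] Spans t S
  inducesCopy-spanned {S} (_ , a ∷ b ∷ c ∷ [] , injective , f∈S , onto , edges) = ordered (Fin.<-cmp b c)
    where
    abc : IsStar a b c
    abc = isStar (edges zero (suc zero)) (edges zero (suc (suc zero)))
                 (edges (suc zero) (suc (suc zero))) (edges (suc (suc zero)) (suc zero))
    S≡triple : S ≡ triple a b c
    S≡triple = ⊆-antisym (λ x∈S → ∈-triple⁺ (position (onto _ x∈S))) (λ x∈ → member (∈-triple⁻ x∈))
      where
      position : ∀ {x} → ∃[ i ] lookup (a ∷ b ∷ c ∷ []) i ≡ x → x ≡ a ⊎ x ≡ b ⊎ x ≡ c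
      position (zero           , eq) = inj₁ (sym eq)
      position (suc zero       , eq) = inj₂ (inj₁ (sym eq))
      position (suc (suc zero) , eq) = inj₂ (inj₂ (sym eq))
      member : ∀ {x} → x ≡ a ⊎ x ≡ b ⊎ x ≡ c → x Subset.∈ S
      member (inj₁ refl)        = f∈S zero
      member (inj₂ (inj₁ refl)) = f∈S (suc zero)
      member (inj₂ (inj₂ refl)) = f∈S (suc (suc zero))
    ordered : Tri (b Fin.< c) (b ≡ c) (c Fin.< b) → ∃[ t ] Spans t S
    ordered (tri< b<c _ _) = (a , b , c) , (isStar⇒star abc , b<c) , S≡triple
    ordered (tri≈ _ b≡c _) = contradiction (injective (suc zero) (suc (suc zero)) b≡c) λ ()
    -- An isomorphism may list the leaves in decreasing order; the star is symmetric in them.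
    ordered (tri> _ _ c<b) = (a , c , b) ,
      (trans (Stars.star-comm E a c b) (isStar⇒star abc) , c<b) ,
      trans S≡triple (cong (⁅ a ⁆ ∪_) (∪-comm ⁅ b ⁆ ⁅ c ⁆))

  #induced≡#orderedStars : #induced (digraph K₁,₂) (digraph G) ≡ length (filter orderedStar? Vs)
  #induced≡#orderedStars = ≤-antisym
    (pigeonhole {R = λ S t → Spans t S} (λ (_ , eq) (_ , eq′) → trans eq (sym eq′))
      (Unique.filter⁺ copy? (subsets-unique n)) λ S∈ →
        let t , st , eq = inducesCopy-spanned (proj₂ (∈-filter⁻ copy? {xs = subsets n} S∈)) in
        t , ∈-filter⁺ orderedStar? (everywhere t) st , st , eq)
    (pigeonhole {R = Spans} spans-injective
      (Unique.filter⁺ orderedStar? (Unique.cartesianProduct⁺ V! (Unique.cartesianProduct⁺ V! V!)))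
      λ t∈ → let st , b<c = proj₂ (∈-filter⁻ orderedStar? {xs = Vs} t∈) in
        _ , ∈-filter⁺ copy? (vecs-complete bools-complete _)
              (triple-inducesCopy (star⇒isStar st) (Fin.<⇒≢ b<c)) , (st , b<c) , refl)
    where
    copy? = inducesCopy? (digraph K₁,₂) (digraph G)
    V! = Unique.allFin⁺ n
    everywhere : ∀ t → t ∈ Vs
    everywhere (a , b , c) =
      ∈-cartesianProduct⁺ (∈-allFin a) (∈-cartesianProduct⁺ (∈-allFin b) (∈-allFin c))

  -- The second copy of the sum is written with its leaves exchanged. The conditions b < c and c < b
  -- together amount to b ≠ c, which is the factor `δ b c`.
  2#induced : 2 * #induced (digraph K₁,₂) (digraph G) ≡
              ∑ V (λ a → ∑ V λ b → ∑ V λ c → δ b c * star E a b c)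
  2#induced = begin
    2 * #induced (digraph K₁,₂) (digraph G)
      ≡⟨ cong (2 *_) (trans #induced≡#orderedStars (length-filter≡∑ orderedStar? Vs)) ⟩
    2 * ∑ Vs (λ t → ⟦ does (orderedStar? t) ⟧)
      ≡⟨ cong (2 *_) (trans (∑-cartesianProductWith _,_ V (cartesianProduct V V) (λ t → ⟦ does (orderedStar? t) ⟧))
           (∑-cong V λ a → ∑-cartesianProductWith _,_ V V (λ (b , c) → ⟦ does (orderedStar? (a , b , c)) ⟧))) ⟩
    2 * ∑ V (λ a → ∑ V λ b → ∑ V λ c → ⟦ does (orderedStar? (a , b , c)) ⟧)
      ≡⟨ cong (2 *_) (∑-cong V λ a → ∑-cong V λ b → ∑-cong V λ c →
           indicator (star E a b c) (Stars.star≤1 E a b c) (b Fin.<? c)) ⟩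
    2 * ∑ V (λ a → ∑ V λ b → ∑ V λ c → below a b c)
      ≡⟨ ∑-* V 2 (λ a → ∑ V λ b → ∑ V λ c → below a b c) ⟨
    ∑ V (λ a → 2 * ∑ V λ b → ∑ V λ c → below a b c)
      ≡⟨ ∑-cong V (λ a → cong ((∑ V λ b → ∑ V λ c → below a b c) +_) (trans (+-identityʳ _)
           (trans (∑-comm V V (below a)) (∑-cong V λ b → ∑-cong V λ c →
             cong (⟦ does (c Fin.<? b) ⟧ *_) (Stars.star-comm E a c b))))) ⟩
    ∑ V (λ a → (∑ V λ b → ∑ V λ c → below a b c) + (∑ V λ b → ∑ V λ c → above a b c))
      ≡⟨ ∑-cong V (λ a → trans (sym (∑-+ V (λ b → ∑ V (below a b)) (λ b → ∑ V (above a b))))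
           (∑-cong V λ b → trans (sym (∑-+ V (below a b) (above a b)))
             (∑-cong V λ c → trichotomy b c (star E a b c)))) ⟩
    ∑ V (λ a → ∑ V λ b → ∑ V λ c → δ b c * star E a b c) ∎
    where
    open ≡-Reasoning
    below above : Fin n → Fin n → Fin n → ℕ
    below a b c = ⟦ does (b Fin.<? c) ⟧ * star E a b c
    above a b c = ⟦ does (c Fin.<? b) ⟧ * star E a b c
    indicator : ∀ s → s ≤ 1 → {P : Set} (P? : Dec P) →
                ⟦ does ((s ≟ 1) ×-dec P?) ⟧ ≡ ⟦ does P? ⟧ * s
    indicator zero          _ (yes _) = refl
    indicator zero          _ (no _)  = refl
    indicator (suc zero)    _ (yes _) = refl
    indicator (suc zero)    _ (no _)  = refl
    indicator (suc (suc _)) (s≤s ())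
    order : ∀ {x y z x′ y′ z′ s} → x ≡ x′ → y ≡ y′ → z ≡ z′ →
            ⟦ x′ ⟧ * s + ⟦ y′ ⟧ * s ≡ ⟦ not z′ ⟧ * s → ⟦ x ⟧ * s + ⟦ y ⟧ * s ≡ ⟦ not z ⟧ * s
    order refl refl refl eq = eq
    trichotomy : ∀ b c s → ⟦ does (b Fin.<? c) ⟧ * s + ⟦ does (c Fin.<? b) ⟧ * s ≡ δ b c * s
    trichotomy b c s with Fin.<-cmp b c
    ... | tri< b<c b≢c c≮b = order (dec-true (b Fin.<? c) b<c) (dec-false (c Fin.<? b) c≮b)
                                   (dec-false (b Fin.≟ c) b≢c) (+-identityʳ _)
    ... | tri≈ b≮c b≡c c≮b = order (dec-false (b Fin.<? c) b≮c) (dec-false (c Fin.<? b) c≮b)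
                                   (dec-true (b Fin.≟ c) b≡c) refl
    ... | tri> b≮c b≢c c<b = order (dec-false (b Fin.<? c) b≮c) (dec-true (c Fin.<? b) c<b)
                                   (dec-false (b Fin.≟ c) b≢c) refl

  #stars : ℕ
  #stars = ∑ V λ a → ∑ V λ b → ∑ V λ c → star E a b c

  2#induced≤#stars : 2 * #induced (digraph K₁,₂) (digraph G) ≤ #stars
  2#induced≤#stars = ≤-trans (≤-reflexive 2#induced)
    (∑-mono V λ a → ∑-mono V λ b → ∑-mono V λ c →
      ≤-trans (*-monoˡ-≤ _ ⟦ not (does (b Fin.≟ c)) ⟧≤1) (≤-reflexive (*-identityˡ _)))

  -- The two further factors change nothing, since the centre differs from its leaves by
  -- irreflexivity. They provide the three distinct indices that `resample³` asks for.
  2#induced-distinct : 2 * #induced (digraph K₁,₂) (digraph G) ≡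
    ∑ V (λ a → ∑ V λ b → ∑ V λ c → δ a b * (δ a c * δ b c) * star E a b c)
  2#induced-distinct = trans 2#induced (∑-cong V λ a → ∑-cong V λ b → ∑-cong V λ c → pointwise a b c)
    where
    pointwise : ∀ a b c → δ b c * star E a b c ≡ δ a b * (δ a c * δ b c) * star E a b c
    pointwise a b c with a Fin.≟ b | a Fin.≟ c
    ... | yes refl | _        = trans (cong (δ b c *_) (Stars.star-no-edgeˡ E c (irrefl a))) (*-zeroʳ (δ b c))
    ... | no _     | yes refl = trans (cong (δ b c *_) (Stars.star-no-edgeʳ E b (irrefl a))) (*-zeroʳ (δ b c))
    ... | no _     | no _     = cong (_* star E a b c) {δ b c} (sym (trans (*-identityˡ _) (*-identityˡ _)))

-- Pullbacks and averaging

fromEdges : (Fin n → Fin n → Bool) → Digraph n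
fromEdges E = Vec.tabulate λ i → Vec.tabulate (E i)

edge-fromEdges : ∀ (E : Fin n → Fin n → Bool) i j → edge (fromEdges E) i j ≡ E i j
edge-fromEdges E i j = trans (cong (λ row → lookup row j) (lookup∘tabulate (λ i → Vec.tabulate (E i)) i))
                             (lookup∘tabulate (E i) j)

-- Vertices with the same image become non-adjacent twins, as in a blow-up. This is why stars of G
-- with coinciding leaves count: they become genuine induced stars.
pullback : ∀ {N} → Orgraph n → (Fin N → Fin n) → Orgraph N
pullback G φ = orgraph (fromEdges E)
  ( (λ i → trans (edge-fromEdges E i i) (proj₁ (isOrgraph G) (φ i)))
  , (λ i j ij → trans (edge-fromEdges E j i)
      (proj₂ (isOrgraph G) (φ i) (φ j) (trans (sym (edge-fromEdges E i j)) ij))))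
  where
  E = λ i j → edge (digraph G) (φ i) (φ j)

star-pullback : ∀ {N} (G : Orgraph n) (φ : Fin N → Fin n) i j k →
  star (edge (digraph (pullback G φ))) i j k ≡ star (edge (digraph G)) (φ i) (φ j) (φ k)
star-pullback G φ i j k
  rewrite edge-fromEdges (λ i j → edge (digraph G) (φ i) (φ j)) i j
        | edge-fromEdges (λ i j → edge (digraph G) (φ i) (φ j)) i k
        | edge-fromEdges (λ i j → edge (digraph G) (φ i) (φ j)) j k
        | edge-fromEdges (λ i j → edge (digraph G) (φ i) (φ j)) k j = refl

-- Average the number of induced stars of the pullback of G along all maps
-- from N vertices into G.
averaging : ∀ (G : Orgraph (suc n)) N →
  suc (suc N) * (suc N * N) * #stars G ≤
  suc n * (suc n * (suc n * (2 * maxInduced K₁,₂ (suc (suc N)))))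
-- L is the number of maps, the denominator of the average; it is multiplied in and cancelled at the
-- end.
averaging {n} G N = *-cancelˡ-≤ L (begin
  L * (suc (suc N) * (suc N * N) * #stars G)
    ≡⟨ cong (λ d → L * (d * #stars G)) (∑-distinct N) ⟨
  L * ((∑ W λ i → ∑ W λ j → ∑ W λ k → d i j k) * #stars G)
    ≡⟨ rearr L _ (#stars G) ⟩
  L * #stars G * (∑ W λ i → ∑ W λ j → ∑ W λ k → d i j k)
    ≡⟨ trans (∑-cong W λ i → trans (∑-cong W λ j → ∑-* W (L * #stars G) (d i j)) (∑-* W (L * #stars G) _))
             (∑-* W (L * #stars G) _) ⟨
  (∑ W λ i → ∑ W λ j → ∑ W λ k → L * #stars G * d i j k)
    ≡⟨ ∑-cong W (λ i → ∑-cong W λ j → ∑-cong W λ k → resampled i j k) ⟩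
  (∑ W λ i → ∑ W λ j → ∑ W λ k → m * (m * (m * ∑ Φ λ φ → d i j k * pulled φ i j k)))
    ≡⟨ pull-cubed ⟩
  m * (m * (m * (∑ W λ i → ∑ W λ j → ∑ W λ k → ∑ Φ λ φ → d i j k * pulled φ i j k)))
    ≡⟨ cong (λ s → m * (m * (m * s))) exchange ⟩
  m * (m * (m * (∑ Φ λ φ → ∑ W λ i → ∑ W λ j → ∑ W λ k → d i j k * pulled φ i j k)))
    ≤⟨ *-monoʳ-≤ m (*-monoʳ-≤ m (*-monoʳ-≤ m (∑-mono Φ bound))) ⟩
  m * (m * (m * (∑ Φ λ φ → 2 * M)))
    ≡⟨ cong (λ s → m * (m * (m * s))) (∑-const Φ (2 * M)) ⟩
  m * (m * (m * (L * (2 * M))))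
    ≡⟨ rearr′ m L (2 * M) ⟩
  L * (m * (m * (m * (2 * M))))
    ≡⟨ cong (λ m → L * (m * (m * (m * (2 * M))))) (length-allFin (suc n)) ⟩
  L * (suc n * (suc n * (suc n * (2 * M)))) ∎)
  where
  open ≤-Reasoning
  U = allFin (suc n)
  W = allFin (suc (suc N))
  Φ = vecs U (suc (suc N))
  L = length Φ
  m = length U
  M = maxInduced K₁,₂ (suc (suc N))
  d : Fin (suc (suc N)) → Fin (suc (suc N)) → Fin (suc (suc N)) → ℕ
  d i j k = δ i j * (δ i k * δ j k)
  pulled : Vec (Fin (suc n)) (suc (suc N)) → Fin (suc (suc N)) → Fin (suc (suc N)) → Fin (suc (suc N)) → ℕ
  pulled φ i j k = star (edge (digraph G)) (lookup φ i) (lookup φ j) (lookup φ k)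
  instance
    L≢0 : NonZero L
    -- The constant map to `zero` shows that there is at least one map.
    L≢0 with Φ | vecs-complete ∈-allFin (Vec.replicate (suc (suc N)) (Fin.zero {n}))
    ... | _ ∷ _ | _ = _
  rearr : ∀ a b c → a * (b * c) ≡ a * c * b
  rearr = solve-∀
  rearr′ : ∀ m l t → m * (m * (m * (l * t))) ≡ l * (m * (m * (m * t)))
  rearr′ = solve-∀
  resampled : ∀ i j k → L * #stars G * d i j k ≡ m * (m * (m * ∑ Φ λ φ → d i j k * pulled φ i j k))
  resampled i j k = trans cases (trans (rearr″ m (∑ Φ λ φ → pulled φ i j k) (d i j k))
      (cong (λ s → m * (m * (m * s))) (sym (∑-* Φ (d i j k) (λ φ → pulled φ i j k)))))
    where
    rearr″ : ∀ m s d → m * (m * (m * s)) * d ≡ m * (m * (m * (d * s)))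
    rearr″ = solve-∀
    -- If two of the indices coincide, the factor d vanishes and both sides are 0; otherwise
    -- `resample³` applies.
    cases : L * #stars G * d i j k ≡ m * (m * (m * ∑ Φ λ φ → pulled φ i j k)) * d i j k
    cases with d i j k in d≡ | m * (m * (m * ∑ Φ λ φ → pulled φ i j k)) in X≡
    ... | zero  | X = trans (*-zeroʳ (L * #stars G)) (sym (*-zeroʳ X))
    ... | suc e | X = cong (_* suc e) (trans (sym (resample³ U i≢j i≢k j≢k (star (edge (digraph G))))) X≡)
      where
      d≢0 : d i j k ≢ 0
      d≢0 d≡0 = contradiction (trans (sym d≡) d≡0) λ ()
      δ-refl : ∀ {n} (v : Fin n) → δ v v ≡ 0
      δ-refl v = cong (λ b → ⟦ not b ⟧) (dec-true (v Fin.≟ v) refl)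
      i≢j : i ≢ j
      i≢j refl = d≢0 (cong (_* (δ i k * δ i k)) (δ-refl i))
      i≢k : i ≢ k
      i≢k refl = d≢0 (trans (cong (λ z → δ i j * (z * δ j i)) (δ-refl i)) (*-zeroʳ (δ i j)))
      j≢k : j ≢ k
      j≢k refl = d≢0 (trans (cong (λ z → δ i j * (δ i j * z)) (δ-refl j))
                     (trans (cong (δ i j *_) (*-zeroʳ (δ i j))) (*-zeroʳ (δ i j))))
  pull : ∀ {A : Set} (xs : List A) (f : A → ℕ) → ∑ xs (λ x → m * (m * (m * f x))) ≡ m * (m * (m * ∑ xs f))
  pull xs f = trans (∑-* xs m _) (cong (m *_) (trans (∑-* xs m _) (cong (m *_) (∑-* xs m f))))
  pull-cubed : (∑ W λ i → ∑ W λ j → ∑ W λ k → m * (m * (m * ∑ Φ λ φ → d i j k * pulled φ i j k))) ≡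
    m * (m * (m * (∑ W λ i → ∑ W λ j → ∑ W λ k → ∑ Φ λ φ → d i j k * pulled φ i j k)))
  pull-cubed = trans (∑-cong W λ i → trans (∑-cong W λ j → pull W (h i j)) (pull W (λ j → ∑ W (h i j))))
                     (pull W (λ i → ∑ W λ j → ∑ W (h i j)))
    where
    h : Fin (suc (suc N)) → Fin (suc (suc N)) → Fin (suc (suc N)) → ℕ
    h i j k = ∑ Φ λ φ → d i j k * pulled φ i j k
  exchange : (∑ W λ i → ∑ W λ j → ∑ W λ k → ∑ Φ λ φ → d i j k * pulled φ i j k) ≡
             (∑ Φ λ φ → ∑ W λ i → ∑ W λ j → ∑ W λ k → d i j k * pulled φ i j k)
  exchange = trans (∑-cong W λ i → trans (∑-cong W λ j → ∑-comm W Φ (λ k φ → d i j k * pulled φ i j k))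
      (∑-comm W Φ (λ j φ → ∑ W λ k → d i j k * pulled φ i j k)))
    (∑-comm W Φ (λ i φ → ∑ W λ j → ∑ W λ k → d i j k * pulled φ i j k))
  bound : ∀ φ → (∑ W λ i → ∑ W λ j → ∑ W λ k → d i j k * pulled φ i j k) ≤ 2 * M
  bound φ = begin
    (∑ W λ i → ∑ W λ j → ∑ W λ k → d i j k * pulled φ i j k)
      ≡⟨ ∑-cong W (λ i → ∑-cong W λ j → ∑-cong W λ k → cong (d i j k *_) (star-pullback G (lookup φ) i j k)) ⟨
    (∑ W λ i → ∑ W λ j → ∑ W λ k → d i j k * star (edge (digraph φ*G)) i j k)
      ≡⟨ 2#induced-distinct φ*G ⟨
    2 * #induced (digraph K₁,₂) (digraph φ*G)
      ≤⟨ *-monoʳ-≤ 2 (maxInduced-upper K₁,₂ φ*G) ⟩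
    2 * M ∎
    where
    φ*G = pullback G (lookup φ)

-- Limits of rational sequences

open import Data.Integer as ℤ using (+_; +[1+_])

-- `ratio` reduces its fraction, so the cross products are compared through unnormalised rationals.
ratio-≤ : ∀ a b c d .{{_ : NonZero c}} .{{_ : NonZero d}} → a * d ≤ b * c → ratio a c ℚ.≤ ratio b d
ratio-≤ a b c@(suc c-1) d@(suc d-1) ad≤bc = ℚ.toℚᵘ-cancel-≤
  (ℚᵘ.≤-respˡ-≃ (ℚᵘ.≃-sym (ℚ.toℚᵘ-fromℚᵘ (mkℚᵘ (+ a) c-1)))
  (ℚᵘ.≤-respʳ-≃ (ℚᵘ.≃-sym (ℚ.toℚᵘ-fromℚᵘ (mkℚᵘ (+ b) d-1)))
  (*≤* (subst₂ ℤ._≤_ (ℤ.pos-* a d) (ℤ.pos-* b c) (ℤ.+≤+ ad≤bc)))))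

ratio-+ : ∀ a b d .{{_ : NonZero d}} → ratio a d ℚ.+ ratio b d ≡ ratio (a + b) d
ratio-+ a b d@(suc d-1) = ℚ.toℚᵘ-injective
  (ℚᵘ.≃-trans (ℚ.toℚᵘ-homo-+ (ratio a d) (ratio b d))
  (ℚᵘ.≃-trans (ℚᵘ.+-cong (ℚ.toℚᵘ-fromℚᵘ (mkℚᵘ (+ a) d-1)) (ℚ.toℚᵘ-fromℚᵘ (mkℚᵘ (+ b) d-1)))
  (ℚᵘ.≃-trans (*≡* (cross (+ a) (+ b) (+ d))) (ℚᵘ.≃-sym (ℚ.toℚᵘ-fromℚᵘ (mkℚᵘ (+ (a + b)) d-1))))))
  where
  cross : ∀ a b d → (a ℤ.* d ℤ.+ b ℤ.* d) ℤ.* d ≡ (a ℤ.+ b) ℤ.* (d ℤ.* d)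
  cross = ℤ.solve-∀

ratio-< : ∀ a c {b d-1} .{coprime : Coprime b (suc d-1)} .{{_ : NonZero c}} → a * suc d-1 < b * c →
          ratio a c ℚ.< mkℚ (+ b) d-1 coprime
ratio-< a c@(suc c-1) {b} {d-1} ad<bc = ℚ.toℚᵘ-cancel-<
  (ℚᵘ.<-respˡ-≃ (ℚᵘ.≃-sym (ℚ.toℚᵘ-fromℚᵘ (mkℚᵘ (+ a) c-1)))
  (*<* (subst₂ ℤ._<_ (ℤ.pos-* a (suc d-1)) (ℤ.pos-* b c) (ℤ.+<+ ad<bc))))

ratio-vanishes : ∀ a ε → 0ℚ ℚ.< ε →
  ∃[ K ] ∀ n .{{_ : NonZero n}} → K ≤ n → ratio (a * (n * n)) (n * (n * n)) ℚ.< ε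
-- The ratio is a / n, and ε = (b + 1) / d has numerator at least 1, so every n > a d is large
-- enough.
ratio-vanishes a (mkℚ +[1+ b ] d-1 _) _ = suc (a * suc d-1) , below
  where
  open ≤-Reasoning
  rearr : ∀ a b c → a * b * c ≡ a * c * b
  rearr = solve-∀
  below : ∀ n .{{_ : NonZero n}} → a * suc d-1 < n → ratio (a * (n * n)) (n * (n * n)) ℚ.< _
  below n@(suc _) K≤n = ratio-< (a * (n * n)) (n * (n * n)) (begin-strict
    a * (n * n) * suc d-1     ≡⟨ rearr a (n * n) (suc d-1) ⟩
    a * suc d-1 * (n * n)     <⟨ *-monoˡ-< (n * n) K≤n ⟩
    n * (n * n)               ≤⟨ m≤n*m (n * (n * n)) (suc b) ⟩
    suc b * (n * (n * n)) ∎)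
ratio-vanishes a (mkℚ (+ zero) _ _) (ℚ.*<* (ℤ.+<+ ()))
ratio-vanishes a (mkℚ (ℤ.-[1+ _ ]) _ _) (ℚ.*<* ())

0<q-p : ∀ {p q} → p ℚ.< q → 0ℚ ℚ.< q ℚ.- p
0<q-p {p} {q} p<q = subst (ℚ._< q ℚ.- p) (ℚ.+-inverseʳ p) (ℚ.+-monoˡ-< (ℚ.- p) p<q)

p+[q-p]≡q : ∀ p q → p ℚ.+ (q ℚ.- p) ≡ q
p+[q-p]≡q = solve 2 (λ p q → p :+ (q :- p) := q) refl
  where open +-*-Solver

p-1<p : ∀ p → p ℚ.- 1ℚ ℚ.< p
p-1<p p = subst (p ℚ.- 1ℚ ℚ.<_) (ℚ.+-identityʳ p)
  (ℚ.+-monoʳ-< p {ℚ.- 1ℚ} {0ℚ} (from-yes (ℚ.- 1ℚ ℚ.<? 0ℚ)))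

p<p+1 : ∀ p → p ℚ.< p ℚ.+ 1ℚ
p<p+1 p = subst (ℚ._< p ℚ.+ 1ℚ) (ℚ.+-identityʳ p)
  (ℚ.+-monoʳ-< p {0ℚ} {1ℚ} (from-yes (0ℚ ℚ.<? 1ℚ)))

-- Every e lies below every d and the gap at n is at most r n, so the supremum of e and the infimum
-- of d agree. The rate r makes this common value a located cut, and d converges to it.
module Squeeze (e d r : ℕ → ℚ)
  (e≤d : ∀ m n → e m ℚ.≤ d n)
  (d≤e+r : ∀ n → d n ℚ.≤ e n ℚ.+ r n)
  (r→0 : ∀ ε → 0ℚ ℚ.< ε → ∃[ K ] ∀ n → K ≤ n → r n ℚ.< ε) where

  d<q : ∀ {p q} → p ℚ.< q → ∃[ K ] ∀ n → K ≤ n → e n ℚ.≤ p → d n ℚ.< q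
  d<q {p} {q} p<q with r→0 (q ℚ.- p) (0<q-p p<q)
  ... | K , r<q-p = K , λ n K≤n en≤p →
    ℚ.≤-<-trans (d≤e+r n) (subst (e n ℚ.+ r n ℚ.<_) (p+[q-p]≡q p q) (ℚ.+-mono-≤-< {e n} {p} {r n} {q ℚ.- p} en≤p (r<q-p n K≤n)))

  limit : ℝ
  limit = record
    { lower           = λ q → ∃[ n ] q ℚ.< e n
    ; upper           = λ q → ∃[ n ] d n ℚ.< q
    ; lower-inhabited = e 0 ℚ.- 1ℚ , 0 , p-1<p (e 0)
    ; upper-inhabited = d 0 ℚ.+ 1ℚ , 0 , p<p+1 (d 0)
    ; lower-closed    = λ p<q (n , q<e) → n , ℚ.<-trans p<q q<e
    ; upper-closed    = λ p<q (n , d<p) → n , ℚ.<-trans d<p p<q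
    ; lower-open      = λ (n , p<e) → let q , p<q , q<e = ℚ.<-dense p<e in q , p<q , n , q<e
    ; upper-open      = λ (n , d<q) → let p , d<p , p<q = ℚ.<-dense d<q in p , p<q , n , d<p
    ; disjoint        = λ (m , q<e) (n , d<q) →
                          ℚ.<-irrefl refl (ℚ.<-≤-trans (ℚ.<-trans d<q q<e) (e≤d m n))
    ; located         = loc
    }
    where
    loc : ∀ {p q} → p ℚ.< q → (∃[ n ] p ℚ.< e n) ⊎ (∃[ n ] d n ℚ.< q)
    -- At an index K where r is below q - p, either e K exceeds p, or e K ≤ p and then d K < q.
    loc {p} {q} p<q = let K , bound = d<q p<q in decide K (bound K ≤-refl)
      where
      decide : ∀ K → (e K ℚ.≤ p → d K ℚ.< q) → (∃[ n ] p ℚ.< e n) ⊎ (∃[ n ] d n ℚ.< q)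
      decide K bound with p ℚ.<? e K
      ... | yes p<e = inj₁ (K , p<e)
      ... | no  p≮e = inj₂ (K , bound (ℚ.≮⇒≥ p≮e))

  limit-isLimsup : IsLimsup d limit
  limit-isLimsup =
      -- Here `d<q` is used with p = d N, which bounds every e n from above.
      (λ q (N , dN<q) → let K , bound = d<q dN<q in K , λ n K≤n → bound n K≤n (e≤d n N))
    , (λ q (m , q<em) N → N , ≤-refl , ℚ.<-≤-trans q<em (e≤d m N))

IsLimsup-shift : ∀ {a x} k → IsLimsup (λ n → a (k + n)) x → IsLimsup a x
IsLimsup-shift {a} k (eventually , often) =
    (λ q u → let N , below = eventually q u in k + N , λ n k+N≤n →
      subst (λ n → a n ℚ.< q) (m+[n∸m]≡n (m+n≤o⇒m≤o k k+N≤n))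
        (below (n ∸ k) (m+n≤o⇒m≤o∸n N (subst (_≤ n) (+-comm k N) k+N≤n))))
  , (λ q l N → let n , N≤n , q<a = often q l N in k + n , ≤-trans N≤n (m≤n+m n k) , q<a)

IsLimsup-cong : ∀ {a b x} → (∀ n → a n ≡ b n) → IsLimsup a x → IsLimsup b x
IsLimsup-cong eq (eventually , often) =
    (λ q u → let N , below = eventually q u in N , λ n N≤n → subst (ℚ._< q) (eq n) (below n N≤n))
  , (λ q l N → let n , N≤n , q<a = often q l N in n , N≤n , subst (q ℚ.<_) (eq n) q<a)

-- Inducibility

maxInduced-elim : ∀ {k} (Γ : Orgraph k) n (P : ℕ → Set) →
  (∀ (G : Orgraph n) → P (#induced (digraph Γ) (digraph G))) → P (maxInduced Γ n)
maxInduced-elim Γ n P h = let G , #G≡M = maxInduced-attained Γ n in subst P #G≡M (h G)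

-- `averaging` for each orgraph on m + 1 vertices, whose `#stars` is at least twice its number of
-- induced stars. With n = m + 1 and N + 2 vertices in the pullback, it compares 6 M(n) / n³ with
-- the density at N + 2, denominators cleared.
cross-bound : ∀ m N → 6 * (suc (suc N) C 3) * maxInduced K₁,₂ (suc m) ≤
              suc m * (suc m * suc m) * maxInduced K₁,₂ (suc (suc N))
cross-bound m N = maxInduced-elim K₁,₂ (suc m)
  (λ s → 6 * (suc (suc N) C 3) * s ≤ suc m * (suc m * suc m) * M) bound
  where
  open ≤-Reasoning
  M = maxInduced K₁,₂ (suc (suc N))
  D = suc (suc N) * (suc N * N)
  rearr : ∀ a b → 2 * (a * b) ≡ a * (2 * b)
  rearr = solve-∀
  rearr′ : ∀ m M → m * (m * (m * (2 * M))) ≡ 2 * (m * (m * m) * M)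
  rearr′ = solve-∀
  bound : ∀ G → 6 * (suc (suc N) C 3) * #induced (digraph K₁,₂) (digraph G) ≤ suc m * (suc m * suc m) * M
  bound G = *-cancelˡ-≤ 2 (begin
    2 * (6 * (suc (suc N) C 3) * #G)      ≡⟨ cong (λ c → 2 * (c * #G)) (6*nC3 N) ⟩
    2 * (D * #G)                          ≡⟨ rearr D #G ⟩
    D * (2 * #G)                          ≤⟨ *-monoʳ-≤ D (2#induced≤#stars G) ⟩
    D * #stars G                          ≤⟨ averaging G N ⟩
    suc m * (suc m * (suc m * (2 * M)))   ≡⟨ rearr′ (suc m) M ⟩
    2 * (suc m * (suc m * suc m) * M) ∎)
    where #G = #induced (digraph K₁,₂) (digraph G)

-- Each set of three vertices has six orders and only the exchange of the leaves is divided out,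
-- hence the 3. The bound is crude, but it only enters the error term.
maxInduced≤3C : ∀ N → maxInduced K₁,₂ (suc (suc N)) ≤ 3 * (suc (suc N) C 3)
maxInduced≤3C N = maxInduced-elim K₁,₂ (suc (suc N)) (_≤ 3 * (suc (suc N) C 3)) bound
  where
  open ≤-Reasoning
  V = allFin (suc (suc N))
  bound : ∀ G → #induced (digraph K₁,₂) (digraph G) ≤ 3 * (suc (suc N) C 3)
  bound G = *-cancelˡ-≤ 2 (begin
    2 * #induced (digraph K₁,₂) (digraph G)
      ≡⟨ 2#induced-distinct G ⟩
    (∑ V λ a → ∑ V λ b → ∑ V λ c → δ a b * (δ a c * δ b c) * star E a b c)
      ≤⟨ ∑-mono V (λ a → ∑-mono V λ b → ∑-mono V λ c → ≤-trans
           (*-monoʳ-≤ (δ a b * (δ a c * δ b c)) (Stars.star≤1 E a b c)) (≤-reflexive (*-identityʳ (δ a b * (δ a c * δ b c))))) ⟩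
    (∑ V λ a → ∑ V λ b → ∑ V λ c → δ a b * (δ a c * δ b c))
      ≡⟨ trans (∑-distinct N) (sym (6*nC3 N)) ⟩
    6 * (suc (suc N) C 3)
      ≡⟨ *-assoc 2 3 (suc (suc N) C 3) ⟩
    2 * (3 * (suc (suc N) C 3)) ∎)
    where E = edge (digraph G)

#stars≤ : ∀ (G : Orgraph n) m k .{{_ : NonZero k}} → m * m ≤ 12 * (k * k) →
          (m + 3 * k) * #stars G ≤ k * (n * n * n)
#stars≤ {n} G m k m²≤12k² = subst₂ (λ s w → (m + 3 * k) * s ≤ k * (w * w * w)) stars≡ weight≡
  (stars-bound (proj₁ (isOrgraph G)) (proj₂ (isOrgraph G)) m k m²≤12k² W)
  where
  V = allFin n
  open Stars (edge (digraph G)) hiding (star)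
  W : Weighted
  W = map (_, 1) V
  weight≡ : weight W ≡ n
  weight≡ = trans (∑-map (_, 1) V proj₂) (∑-ones n)
  ones : ∀ s → 1 * (1 * (1 * s)) ≡ s
  ones = solve-∀
  stars≡ : stars W ≡ #stars G
  stars≡ = trans (∑-map (_, 1) V _) (∑-cong V λ a →
    trans (∑-map (_, 1) V _) (∑-cong V λ b →
    trans (∑-map (_, 1) V _) (∑-cong V λ c → ones (star (edge (digraph G)) a b c))))

-- The form in which `ratio-≤` reads off 6 M(n) / n³ ≤ 3k / (m + 3k).
maxInduced≤ : ∀ m k .{{_ : NonZero k}} → m * m ≤ 12 * (k * k) → ∀ n →
  6 * maxInduced K₁,₂ n * (m + 3 * k) ≤ 3 * k * (n * (n * n))
maxInduced≤ m k m²≤12k² n = maxInduced-elim K₁,₂ n (λ s → 6 * s * c ≤ 3 * k * (n * (n * n))) bound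
  where
  open ≤-Reasoning
  c = m + 3 * k
  rearr : ∀ x c → 6 * x * c ≡ 3 * (c * (2 * x))
  rearr = solve-∀
  rearr′ : ∀ k n → 3 * (k * (n * n * n)) ≡ 3 * k * (n * (n * n))
  rearr′ = solve-∀
  bound : ∀ G → 6 * #induced (digraph K₁,₂) (digraph G) * c ≤ 3 * k * (n * (n * n))
  bound G = begin
    6 * #G * c              ≡⟨ rearr #G c ⟩
    3 * (c * (2 * #G))      ≤⟨ *-monoʳ-≤ 3 (*-monoʳ-≤ c (2#induced≤#stars G)) ⟩
    3 * (c * #stars G)      ≤⟨ *-monoʳ-≤ 3 (#stars≤ G m k m²≤12k²) ⟩
    3 * (k * (n * n * n))   ≡⟨ rearr′ k n ⟩
    3 * k * (n * (n * n)) ∎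
    where #G = #induced (digraph K₁,₂) (digraph G)

-- Reversal of edges

length-filter-mono : ∀ {P Q : A → Set} (P? : Decidable P) (Q? : Decidable Q) → (∀ x → P x → Q x) →
  ∀ xs → length (filter P? xs) ≤ length (filter Q? xs)
length-filter-mono P? Q? P⇒Q []       = z≤n
length-filter-mono P? Q? P⇒Q (x ∷ xs) with P? x | Q? x
... | yes _  | yes _ = s≤s (length-filter-mono P? Q? P⇒Q xs)
... | yes Px | no ¬Q = contradiction (P⇒Q x Px) ¬Q
... | no _   | yes _ = m≤n⇒m≤1+n (length-filter-mono P? Q? P⇒Q xs)
... | no _   | no _  = length-filter-mono P? Q? P⇒Q xs

transpose : Orgraph n → Orgraph n
transpose G = orgraph (fromEdges E)
  ( (λ i → trans (edge-fromEdges E i i) (proj₁ (isOrgraph G) i))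
  , (λ i j ij → trans (edge-fromEdges E j i) (reversed i j (trans (sym (edge-fromEdges E i j)) ij))))
  where
  E = λ i j → edge (digraph G) j i
  reversed : ∀ i j → edge (digraph G) j i ≡ true → edge (digraph G) i j ≡ false
  reversed i j = proj₂ (isOrgraph G) j i

-- The same vertex sets, with the same isomorphisms, induce copies of the reversed graph once all
-- edges of the host are reversed.
maxInduced-transpose : ∀ {k} (Γ Γᵀ : Orgraph k) →
  (∀ i j → edge (digraph Γ) i j ≡ edge (digraph Γᵀ) j i) → ∀ n → maxInduced Γ n ≤ maxInduced Γᵀ n
maxInduced-transpose Γ Γᵀ Γ≡Γᵀ n = maxInduced-elim Γ n (_≤ maxInduced Γᵀ n) λ G → begin
  #induced (digraph Γ) (digraph G)
    ≤⟨ length-filter-mono (inducesCopy? (digraph Γ) (digraph G))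
         (inducesCopy? (digraph Γᵀ) (digraph (transpose G))) (λ _ → copy G) (subsets n) ⟩
  #induced (digraph Γᵀ) (digraph (transpose G))
    ≤⟨ maxInduced-upper Γᵀ (transpose G) ⟩
  maxInduced Γᵀ n ∎
  where
  open ≤-Reasoning
  copy : ∀ G {T} → InducesCopy (digraph Γ) (digraph G) T → InducesCopy (digraph Γᵀ) (digraph (transpose G)) T
  copy G (size , f , injective , f∈T , onto , edges) = size , f , injective , f∈T , onto , λ i j →
    trans (edge-fromEdges (λ i j → edge (digraph G) j i) (lookup f i) (lookup f j))
          (trans (edges j i) (Γ≡Γᵀ j i))

maxInduced-K₂,₁ : ∀ n → maxInduced K₁,₂ n ≡ maxInduced K₂,₁ n
maxInduced-K₂,₁ n = ≤-antisym
  (maxInduced-transpose K₁,₂ K₂,₁ reverse n)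
  (maxInduced-transpose K₂,₁ K₁,₂ (λ i j → sym (reverse j i)) n)
  where
  reverse : ∀ i j → edge (digraph K₁,₂) i j ≡ edge (digraph K₂,₁) j i
  reverse zero             zero             = refl
  reverse zero             (suc zero)       = refl
  reverse zero             (suc (suc zero)) = refl
  reverse (suc zero)       zero             = refl
  reverse (suc zero)       (suc zero)       = refl
  reverse (suc zero)       (suc (suc zero)) = refl
  reverse (suc (suc zero)) zero             = refl
  reverse (suc (suc zero)) (suc zero)       = refl
  reverse (suc (suc zero)) (suc (suc zero)) = refl

-- The limiting density and its two bounds

nC3≢0 : ∀ k → NonZero ((3 + k) C 3)
nC3≢0 k = ≢-nonZero λ C≡0 → contradiction (trans (sym (6*nC3 (suc k))) (cong (6 *_) C≡0)) λ ()

-- Its 20 induced stars suffice because 6 · 20 / 7³ > 6 - 4√2.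
G₇ : Orgraph 7
G₇ = orgraph D (from-yes (isOrgraph? D))
  where
  -- Vertices 0 and 1 send edges to each of the other five: 2 · C(5,2) = 20 induced stars.
  D = fromEdges λ i j → (toℕ i <ᵇ 2) ∧ not (toℕ j <ᵇ 2)

20≤maxInduced : ∀ n → 7 ≡ n → 20 ≤ maxInduced K₁,₂ n
20≤maxInduced n refl = subst (_≤ maxInduced K₁,₂ 7) #G₇≡20 (maxInduced-upper K₁,₂ G₇)
  where
  #G₇≡20 : #induced (digraph K₁,₂) (digraph G₇) ≡ 20
  -- By evaluation over all 128 vertex sets.
  #G₇≡20 = refl

-- The limiting density of the balanced blow-ups of an optimal orgraph.
blowup : ℕ → ℚ
blowup k = ratio (6 * maxInduced K₁,₂ (3 + k)) ((3 + k) * ((3 + k) * (3 + k)))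

blowup≤density : ∀ m k → blowup m ℚ.≤ density K₁,₂ (3 + k)
blowup≤density m k = ratio-≤ (6 * M m) (M k) ((3 + m) * ((3 + m) * (3 + m))) ((3 + k) C 3) {{_}} {{nC3≢0 k}} (begin
  6 * M m * ((3 + k) C 3)       ≡⟨ rearr (M m) ((3 + k) C 3) ⟩
  6 * ((3 + k) C 3) * M m       ≤⟨ cross-bound (2 + m) (suc k) ⟩
  (3 + m) * ((3 + m) * (3 + m)) * M k ≡⟨ *-comm ((3 + m) * ((3 + m) * (3 + m))) (M k) ⟩
  M k * ((3 + m) * ((3 + m) * (3 + m))) ∎)
  where
  open ≤-Reasoning
  M : ℕ → ℕ
  M k = maxInduced K₁,₂ (3 + k)
  rearr : ∀ a b → 6 * a * b ≡ 6 * b * a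
  rearr = solve-∀

-- This is 9 / n for n = 3 + k, kept over n³ so that `ratio-+` can add it to `blowup`.
error : ℕ → ℚ
error k = ratio (9 * ((3 + k) * (3 + k))) ((3 + k) * ((3 + k) * (3 + k)))

-- For n = 3 + k, replacing n³ by 6 C(n,3) costs at most 3 n². By `maxInduced≤3C` this changes the
-- density by at most 3 · 3 n² / n³.
density≤blowup+error : ∀ k → density K₁,₂ (3 + k) ℚ.≤ blowup k ℚ.+ error k
density≤blowup+error k = subst (density K₁,₂ v ℚ.≤_) (sym (ratio-+ (6 * M) (9 * (v * v)) (v * (v * v))))
  (ratio-≤ M (6 * M + 9 * (v * v)) (v C 3) (v * (v * v)) {{nC3≢0 k}} (begin
    M * (v * (v * v))                 ≤⟨ *-monoʳ-≤ M n³≤ ⟩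
    M * (6 * (v C 3) + 3 * (v * v))   ≡⟨ rearr M (v C 3) (v * v) ⟩
    6 * M * (v C 3) + 3 * (v * v) * M ≤⟨ +-monoʳ-≤ (6 * M * (v C 3)) (*-monoʳ-≤ (3 * (v * v)) (maxInduced≤3C (suc k))) ⟩
    6 * M * (v C 3) + 3 * (v * v) * (3 * (v C 3)) ≡⟨ rearr′ M (v C 3) (v * v) ⟩
    (6 * M + 9 * (v * v)) * (v C 3) ∎))
  where
  open ≤-Reasoning
  v = 3 + k
  M = maxInduced K₁,₂ v
  rearr : ∀ M c s → M * (6 * c + 3 * s) ≡ 6 * M * c + 3 * s * M
  rearr = solve-∀
  rearr′ : ∀ M c s → 6 * M * c + 3 * s * (3 * c) ≡ (6 * M + 9 * s) * c
  rearr′ = solve-∀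
  -- With v = n this is n³ + 2n = n (n - 1) (n - 2) + 3 n².
  expand : ∀ N → let v = suc (suc N) in v * (v * v) + 2 * v ≡ v * (suc N * N) + 3 * (v * v)
  expand = solve-∀
  n³≤ : v * (v * v) ≤ 6 * (v C 3) + 3 * (v * v)
  n³≤ = m+n≤o⇒m≤o (v * (v * v)) (≤-reflexive (trans (expand (suc k)) (cong (_+ 3 * (v * v)) (sym (6*nC3 (suc k))))))

error→0 : ∀ ε → 0ℚ ℚ.< ε → ∃[ K ] ∀ k → K ≤ k → error k ℚ.< ε
error→0 ε 0<ε = let K , below = ratio-vanishes 9 ε 0<ε in
  K , λ k K≤k → below (3 + k) (≤-trans K≤k (m≤n+m k 3))

-- The sequences start at order 3, where C(n,3) is first nonzero; `IsLimsup-shift` then returns to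
-- all orders.
open Squeeze blowup (λ k → density K₁,₂ (3 + k)) error blowup≤density density≤blowup+error error→0

isInducibility-K₁,₂ : IsInducibility K₁,₂ limit
isInducibility-K₁,₂ = IsLimsup-shift {density K₁,₂} {limit} 3 limit-isLimsup

isInducibility-K₂,₁ : IsInducibility K₂,₁ limit
isInducibility-K₂,₁ = IsLimsup-cong {density K₁,₂} {density K₂,₁} {limit}
  (λ n → cong (λ M → ratio M (n C 3)) (maxInduced-K₂,₁ n)) isInducibility-K₁,₂

blowup≤ : ∀ m k .{{_ : NonZero k}} .{{_ : NonZero (m + 3 * k)}} → m * m ≤ 12 * (k * k) →
  ∀ l → blowup l ℚ.≤ ratio (3 * k) (m + 3 * k)
blowup≤ m k m²≤12k² l = ratio-≤ (6 * maxInduced K₁,₂ (3 + l)) (3 * k) ((3 + l) * ((3 + l) * (3 + l))) (m + 3 * k)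
  (maxInduced≤ m k m²≤12k² (3 + l))

-- m² ≤ 12 k² means 3k / (m + 3k) ≥ 2√3 - 3, and 3 · 387 / (1339 + 3 · 387) = 0.4644.
limit≤0·4644 : limit ≤ᴿ fromℚ (+ 4644 / 10000)
-- Evaluation decides 1339² = 1792921 ≤ 1797228 = 12 · 387², and 1161 / 2500 reduces to the same
-- fraction as 4644 / 10000.
limit≤0·4644 q (k , q<e) = ℚ.<-≤-trans q<e (blowup≤ 1339 387 (≤ᵇ⇒≤ _ _ _) k)

≤blowup : ∀ k {s} → s ≤ maxInduced K₁,₂ (3 + k) → ratio (6 * s) ((3 + k) * ((3 + k) * (3 + k))) ℚ.≤ blowup k
≤blowup k {s} s≤M = ratio-≤ (6 * s) (6 * maxInduced K₁,₂ (3 + k)) n³ n³ (*-monoˡ-≤ n³ (*-monoʳ-≤ 6 s≤M))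
  where n³ = (3 + k) * ((3 + k) * (3 + k))

below-6-4√2 : ∀ q → lower ((+ 6 / 1) -ᴿ (+ 4 / 1) *ᴿ √2) q → q ℚ.< + 120 / 343
below-6-4√2 q (r , r<[6-q]/4 , 0<r , 2<r²) =
  ℚ.<-trans q<6-4s (from-yes ((+ 6 / 1) ℚ.- s ℚ.* (+ 4 / 1) ℚ.<? + 120 / 343))
  where
  s : ℚ
  -- A rational slightly below √2: s² = 1.996569, so 2 < r² forces s < r. It is close enough that 6
  -- - 4s = 0.348 is below 120 / 343, about 0.3499.
  s = + 1413 / 1000
  s<r : s ℚ.< r
  s<r = ℚ.≰⇒> λ r≤s → ℚ.<-irrefl refl (ℚ.<-≤-trans 2<r² (begin
    r ℚ.* r ≤⟨ ℚ.*-monoʳ-≤-nonNeg r {{ℚ.nonNegative (ℚ.<⇒≤ 0<r)}} r≤s ⟩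
    s ℚ.* r ≤⟨ ℚ.*-monoˡ-≤-nonNeg s r≤s ⟩
    s ℚ.* s ≤⟨ from-yes (s ℚ.* s ℚ.≤? + 2 / 1) ⟩
    + 2 / 1 ∎))
    where open ℚ.≤-Reasoning
  4s<6-q : s ℚ.* (+ 4 / 1) ℚ.< (+ 6 / 1) ℚ.- q
  4s<6-q = subst (s ℚ.* (+ 4 / 1) ℚ.<_) (cancel ((+ 6 / 1) ℚ.- q))
    (ℚ.*-monoˡ-<-pos (+ 4 / 1) {s} {((+ 6 / 1) ℚ.- q) ℚ.* ℚ.1/ (+ 4 / 1)}
      (ℚ.<-trans s<r r<[6-q]/4))
    where
    cancel : ∀ p → p ℚ.* ℚ.1/ (+ 4 / 1) ℚ.* (+ 4 / 1) ≡ p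
    cancel p = trans (ℚ.*-assoc p (ℚ.1/ (+ 4 / 1)) (+ 4 / 1)) (ℚ.*-identityʳ p)
  c-[c-q]≡q : ∀ c q → c ℚ.- (c ℚ.- q) ≡ q
  c-[c-q]≡q = solve 2 (λ c q → c :- (c :- q) := q) refl
    where open +-*-Solver
  q<6-4s : q ℚ.< (+ 6 / 1) ℚ.- s ℚ.* (+ 4 / 1)
  q<6-4s = subst (ℚ._< (+ 6 / 1) ℚ.- s ℚ.* (+ 4 / 1)) (c-[c-q]≡q (+ 6 / 1) q)
    (ℚ.+-monoʳ-< (+ 6 / 1) {ℚ.- ((+ 6 / 1) ℚ.- q)} {ℚ.- (s ℚ.* (+ 4 / 1))}
      (ℚ.neg-antimono-< {s ℚ.* (+ 4 / 1)} {(+ 6 / 1) ℚ.- q} 4s<6-q))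

6-4√2≤limit : (+ 6 / 1) -ᴿ (+ 4 / 1) *ᴿ √2 ≤ᴿ limit
-- Index 4 stands for order 3 + 4 = 7, where 6 · 20 / 7³ = 120 / 343.
6-4√2≤limit q l = 4 , ℚ.<-≤-trans (below-6-4√2 q l) (≤blowup 4 (20≤maxInduced (3 + 4) refl))

theorem3 : ∃[ x ] ∃[ y ] (
    IsInducibility K₁,₂ x
    × IsInducibility K₂,₁ y
    × (+ 6 / 1) -ᴿ (+ 4 / 1) *ᴿ √2 ≤ᴿ x
    × x ≃ᴿ y
    × y ≤ᴿ fromℚ (+ 4644 / 10000))
theorem3 = limit , limit , isInducibility-K₁,₂ , isInducibility-K₂,₁ ,
  6-4√2≤limit , ((λ _ l → l) , (λ _ l → l)) , limit≤0·4644
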